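{- Fix an arbitrary constant $\epsilon>0$. Let $r=r(n)$ be a positive integer with $r=O\left(\frac{n^{1/3}}{\log^{4/3+\epsilon} n}\right)$. Then the number of metric spaces on the point set $[n]$ all of whose distances lie in $\{1,\ldots,r\}$ is $$\left\lceil\frac{r+1}{2}\right\rceil^{\binom{n}{2}+o(n^2)}.$$
   Context: A metric space on $[n]$ with distances in $\{1,\dots,r\}$ means a function $d:\binom{[n]}{2}\to\{1,\dots,r\}$ such that $d(\{x,y\})\le d(\{x,z\})+d(\{z,y\})$ for all distinct $x,y,z\in[n]$; the points are labelled, so distinct functions are counted as distinct metric spaces. The $o(n^2)$ term is as $n\to\infty$. -}

module Defs where

open import Data.Bool using (Bool; if_then_else_)
open import Data.Nat using (ℕ; zero; suc; _+_; _≤_; _<ᵇ_; _≤?_; _≟_)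
open import Data.Fin using (Fin; toℕ)
import Data.Fin as F
open import Data.Fin.Properties using (all?)
open import Data.List using (List; []; _∷_; map; concatMap; length; filter; allFin)
open import Data.Product using (_×_)
open import Relation.Binary.PropositionalEquality using (_≡_; _≢_)
open import Relation.Nullary using (Dec; ¬?)
open import Relation.Nullary.Decidable using (_→-dec_; _×-dec_)

-- A "table" for a distance function on [n] with values in {1,…,r}:
-- only the entries d x y with toℕ x < toℕ y are meaningful and encode the
-- distance d({x,y}) = 1 + toℕ (d x y); all other entries are required to be 0
-- (normalisation), so tables satisfying Normalised are in bijection with
-- functions (pairs of [n]) → {1,…,r}.
Table : ℕ → ℕ → Set
Table n r = Fin n → Fin n → Fin r

-- distance between x and y (meaningful for x ≢ y), a value in {1,…,r}
dist : ∀ {n r} → Table n r → Fin n → Fin n → ℕ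
dist d x y = suc (toℕ (if toℕ x <ᵇ toℕ y then d x y else d y x))

Normalised : ∀ {n r} → Table n r → Set
Normalised {n} d = (x y : Fin n) → toℕ y ≤ toℕ x → toℕ (d x y) ≡ 0

Triangle : ∀ {n r} → Table n r → Set
Triangle {n} d = (x y z : Fin n) → x ≢ y → x ≢ z → z ≢ y →
  dist d x y ≤ dist d x z + dist d z y

IsMetric : ∀ {n r} → Table n r → Set
IsMetric d = Normalised d × Triangle d

isMetric? : ∀ {n r} (d : Table n r) → Dec (IsMetric d)
isMetric? d =
  all? (λ x → all? (λ y → (toℕ y ≤? toℕ x) →-dec (toℕ (d x y) ≟ 0)))
  ×-dec
  all? (λ x → all? (λ y → all? (λ z →
    ¬? (x F.≟ y) →-dec ¬? (x F.≟ z) →-dec ¬? (z F.≟ y) →-dec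
    (dist d x y ≤? dist d x z + dist d z y))))

consF : ∀ {m} {A : Set} → A → (Fin m → A) → Fin (suc m) → A
consF a f F.zero = a
consF a f (F.suc i) = f i

allFuns : {A : Set} (m : ℕ) → List A → List (Fin m → A)
allFuns zero xs = (λ ()) ∷ []
allFuns (suc m) xs = concatMap (λ a → map (consF a) (allFuns m xs)) xs

numMetrics : ℕ → ℕ → ℕ
numMetrics n r = length (filter isMetric? (allFuns n (allFuns n (allFin r))))

{-# OPTIONS --safe #-}

-- Upper bound.  Reveal the rows of O(r³) landmark points of a metric d, at a cost of m^(o(n²)).
-- Landmarks z give the upper bounds B x y = min (d x z + d y z); adding landmarks greedily as long
-- as they lower ∑ B substantially, one reaches B x y ≤ d x z + d y z for almost all triples.  Now
-- d y z ≥ B x y ∸ d x z for most triples, and the same greedy choice of a few points x produces a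
-- matrix L with L ≤ d at most pairs and B x y ≤ d x z + L y z for almost all triples; once more, with
-- L in place of d, it produces A with B x y ≤ L x z + A y z.  So d x y lies in [A ⊔ L , B] for most
-- pairs, these intervals satisfy all triangle inequalities in almost all triples, and hence three of
-- them have total length at most 3m + 1, where m = ⌈(r+1)/2⌉.  A deletion argument as in Mantel's theorem then
-- shows that an interval has length at most m + o(m) on average, and AM-GM bounds their product.
--
-- Lower bound.  All functions with values in an interval of length m at the top of {1,…,r} are metrics.
module Submission where

open import Defs
open import Data.Bool using (true; false; if_then_else_; T)
open import Data.Empty using (⊥-elim)
open import Data.Fin using (Fin; zero; suc; toℕ)
import Data.Fin as F
open import Data.Fin.Properties using (toℕ<n; toℕ-injective; any?; all?; ¬∀⟶∃¬)
open import Data.List using (List; []; _∷_; _++_; map; concatMap; length; filter; allFin; tabulate; cartesianProductWith; cartesianProduct)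
open import Data.List.Membership.Propositional using (_∈_; find; lose)
open import Data.List.Membership.Propositional.Properties using (∈-∃++; ∈-allFin; ∈-cartesianProductWith⁺)
open import Data.List.Properties using (length-tabulate; length-++; length-map)
open import Data.List.Relation.Binary.Permutation.Propositional as ↭ using (_↭_)
open import Data.List.Relation.Binary.Permutation.Propositional.Properties using (shift; ↭-length)
open import Data.List.Relation.Unary.All as All using (All; []; _∷_)
open import Data.List.Relation.Unary.Any as Any using (here; there)
open import Data.Nat
open import Data.Nat.Combinatorics using (_C_; nC1≡n; nCk+nC[k+1]≡[n+1]C[k+1])
open import Data.Nat.DivMod using (_/_; _%_; m≡m%n+[m/n]*n; m%n<n)
open import Data.Nat.Logarithm using (⌊log₂_⌋; ⌊log₂⌋-mono-≤; ⌊log₂[2^n]⌋≡n)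
open import Data.Nat.Properties
open import Data.Nat.Tactic.RingSolver using (solve-∀)
open import Data.Product using (_×_; _,_; proj₁; proj₂; ∃-syntax)
open import Data.Sum using (_⊎_; inj₁; inj₂)
open import Data.Vec as Vec using (Vec; []; _∷_)
open import Data.Vec.Properties using (lookup∘tabulate)
open import Function using (_∘_)
open import Relation.Binary.Definitions using (tri<; tri≈; tri>)
open import Relation.Binary.PropositionalEquality using (_≡_; _≢_; refl; sym; trans; cong; cong₂; subst; module ≡-Reasoning)
open import Relation.Nullary using (Dec; yes; no; ¬_; ¬?)
open import Relation.Nullary.Decidable using (decidable-stable)
open import Relation.Unary using (Decidable)

-- Finite sums and products

-- The obstacle is to balance precision against cost. A row of `d` costs m^(O(n)), so only o(n)
-- landmarks are affordable; a greedy pass that accepts gains above n²/H stops after H r landmarks,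
-- because the sum it raises never exceeds n² r. Lower bounds read off from a landmark can be false
-- for `d`. Each candidate is therefore charged `λ₀ = h r` for every pair where its bound is false,
-- which leaves at most n²/h such pairs per pass. The charge has a price: it multiplies the number
-- of incompatible triples by 2 `λ₀`. Two passes are needed, since the inequality B x y ≤ d x z + d
-- y z contains `d` twice and a pass replaces one occurrence. So the upper bounds must be precise to
-- `H₁` = (2 `λ₀`)² h, of order r², which takes of order r³ landmarks; rows then cost m^(O(n r³)),
-- and this is o(n²) in the exponent when r³ = o(n). Here h = L², with L a large constant: one
-- factor L is spent on Markov's inequality, from bad triples to pairs with many bad third points,
-- and the other is the final relative error 1/L of the average interval length.

∑ : {A : Set} → List A → (A → ℕ) → ℕ
∑ []       f = 0
∑ (x ∷ xs) f = f x + ∑ xs f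

∏ : {A : Set} → List A → (A → ℕ) → ℕ
∏ []       f = 1
∏ (x ∷ xs) f = f x * ∏ xs f

module _ {A : Set} where

  ∑-mono : (xs : List A) {f g : A → ℕ} → (∀ x → f x ≤ g x) → ∑ xs f ≤ ∑ xs g
  ∑-mono []       h = z≤n
  ∑-mono (x ∷ xs) h = +-mono-≤ (h x) (∑-mono xs h)

  ∑-cong : (xs : List A) {f g : A → ℕ} → (∀ x → f x ≡ g x) → ∑ xs f ≡ ∑ xs g
  ∑-cong []       h = refl
  ∑-cong (x ∷ xs) h = cong₂ _+_ (h x) (∑-cong xs h)

  ∑-+ : (xs : List A) (f g : A → ℕ) → ∑ xs (λ x → f x + g x) ≡ ∑ xs f + ∑ xs g
  ∑-+ []       f g = refl
  ∑-+ (x ∷ xs) f g = trans (cong (f x + g x +_) (∑-+ xs f g)) (interchange (f x) (g x) (∑ xs f) (∑ xs g))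
    where
    interchange : ∀ a b c d → (a + b) + (c + d) ≡ (a + c) + (b + d)
    interchange = solve-∀

  ∑-* : (xs : List A) (c : ℕ) (f : A → ℕ) → ∑ xs (λ x → c * f x) ≡ c * ∑ xs f
  ∑-* []       c f = sym (*-zeroʳ c)
  ∑-* (x ∷ xs) c f = trans (cong (c * f x +_) (∑-* xs c f)) (sym (*-distribˡ-+ c (f x) (∑ xs f)))

  ∑-const : (xs : List A) (c : ℕ) → ∑ xs (λ _ → c) ≡ length xs * c
  ∑-const []       c = refl
  ∑-const (x ∷ xs) c = cong (c +_) (∑-const xs c)

  ∑-bound : (xs : List A) {f : A → ℕ} {c : ℕ} → (∀ x → f x ≤ c) → ∑ xs f ≤ length xs * c
  ∑-bound xs h = ≤-trans (∑-mono xs h) (≤-reflexive (∑-const xs _))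

  ∑-++ : (xs ys : List A) (f : A → ℕ) → ∑ (xs ++ ys) f ≡ ∑ xs f + ∑ ys f
  ∑-++ []       ys f = refl
  ∑-++ (x ∷ xs) ys f = trans (cong (f x +_) (∑-++ xs ys f)) (sym (+-assoc (f x) _ _))

  ∑-∈ : {xs : List A} {x : A} (f : A → ℕ) → x ∈ xs → f x ≤ ∑ xs f
  ∑-∈ f (here refl) = m≤m+n _ _
  ∑-∈ {y ∷ xs} f (there p) = ≤-trans (∑-∈ f p) (m≤n+m _ (f y))

  ∑-↭ : {xs ys : List A} (f : A → ℕ) → xs ↭ ys → ∑ xs f ≡ ∑ ys f
  ∑-↭ f ↭.refl = refl
  ∑-↭ f (↭.prep x p) = cong (f x +_) (∑-↭ f p)
  ∑-↭ f (↭.swap x y p) = trans (cong (λ t → f x + (f y + t)) (∑-↭ f p)) (exchange (f x) (f y) _)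
    where
    exchange : ∀ a b c → a + (b + c) ≡ b + (a + c)
    exchange = solve-∀
  ∑-↭ f (↭.trans p q) = trans (∑-↭ f p) (∑-↭ f q)

  ∏-mono : (xs : List A) {f g : A → ℕ} → (∀ x → f x ≤ g x) → ∏ xs f ≤ ∏ xs g
  ∏-mono []       h = ≤-refl
  ∏-mono (x ∷ xs) h = *-mono-≤ (h x) (∏-mono xs h)

  ∏-cong : (xs : List A) {f g : A → ℕ} → (∀ x → f x ≡ g x) → ∏ xs f ≡ ∏ xs g
  ∏-cong []       h = refl
  ∏-cong (x ∷ xs) h = cong₂ _*_ (h x) (∏-cong xs h)

  ∏-* : (xs : List A) (f g : A → ℕ) → ∏ xs (λ x → f x * g x) ≡ ∏ xs f * ∏ xs g
  ∏-* []       f g = refl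
  ∏-* (x ∷ xs) f g = trans (cong (f x * g x *_) (∏-* xs f g)) (interchange (f x) (g x) (∏ xs f) (∏ xs g))
    where
    interchange : ∀ a b c d → (a * b) * (c * d) ≡ (a * c) * (b * d)
    interchange = solve-∀

  ∏-^ : (xs : List A) (a : ℕ) (f : A → ℕ) → ∏ xs (λ x → a ^ f x) ≡ a ^ ∑ xs f
  ∏-^ []       a f = refl
  ∏-^ (x ∷ xs) a f = trans (cong (a ^ f x *_) (∏-^ xs a f)) (sym (^-distribˡ-+-* a (f x) _))

  ∏≡1 : (xs : List A) {f : A → ℕ} → (∀ x → f x ≡ 1) → ∏ xs f ≡ 1
  ∏≡1 []       h = refl
  ∏≡1 (x ∷ xs) h = cong₂ _*_ (h x) (∏≡1 xs h)

  ∏≡0 : {xs : List A} {x : A} (f : A → ℕ) → x ∈ xs → f x ≡ 0 → ∏ xs f ≡ 0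
  ∏≡0 {_ ∷ xs} f (here refl) eq = cong (_* ∏ xs f) eq
  ∏≡0 {y ∷ xs} f (there p) eq = trans (cong (f y *_) (∏≡0 f p eq)) (*-zeroʳ (f y))

  ∑-filter-≤ : {P : A → Set} (P? : Decidable P) (xs : List A) (f : A → ℕ) (c : ℕ) →
    (∀ x → P x → c ≤ f x) → length (filter P? xs) * c ≤ ∑ xs f
  ∑-filter-≤ P? []       f c h = z≤n
  ∑-filter-≤ P? (x ∷ xs) f c h with P? x
  ... | yes p = +-mono-≤ (h x p) (∑-filter-≤ P? xs f c h)
  ... | no  _ = ≤-trans (∑-filter-≤ P? xs f c h) (m≤n+m _ (f x))

  ∑-filter-≥ : {P : A → Set} (P? : Decidable P) (xs : List A) (f : A → ℕ) →
    (∀ x → f x ≤ 1) → (∀ x → ¬ P x → f x ≡ 0) → ∑ xs f ≤ length (filter P? xs)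
  ∑-filter-≥ P? []       f h₁ h₀ = z≤n
  ∑-filter-≥ P? (x ∷ xs) f h₁ h₀ with P? x
  ... | yes p = +-mono-≤ (h₁ x) (∑-filter-≥ P? xs f h₁ h₀)
  ... | no ¬p = ≤-trans (≤-reflexive (cong (_+ ∑ xs f) (h₀ x ¬p))) (∑-filter-≥ P? xs f h₁ h₀)

module _ {A B : Set} where

  ∑-swap : (xs : List A) (ys : List B) (f : A → B → ℕ) →
    ∑ xs (λ x → ∑ ys (f x)) ≡ ∑ ys (λ y → ∑ xs (λ x → f x y))
  ∑-swap []       ys f = sym (trans (∑-const ys 0) (*-zeroʳ (length ys)))
  ∑-swap (x ∷ xs) ys f = trans (cong (∑ ys (f x) +_) (∑-swap xs ys f)) (sym (∑-+ ys (f x) _))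

  ∑-map : (xs : List A) (g : A → B) (f : B → ℕ) → ∑ (map g xs) f ≡ ∑ xs (f ∘ g)
  ∑-map []       g f = refl
  ∑-map (x ∷ xs) g f = cong (f (g x) +_) (∑-map xs g f)

  ∑-concatMap : (xs : List A) (g : A → List B) (f : B → ℕ) →
    ∑ (concatMap g xs) f ≡ ∑ xs (λ x → ∑ (g x) f)
  ∑-concatMap []       g f = refl
  ∑-concatMap (x ∷ xs) g f = trans (∑-++ (g x) _ f) (cong (∑ (g x) f +_) (∑-concatMap xs g f))

∑-tabulate : {A : Set} (n : ℕ) (g : Fin n → A) (f : A → ℕ) → ∑ (tabulate g) f ≡ ∑ (allFin n) (f ∘ g)
∑-tabulate zero    g f = refl
∑-tabulate (suc n) g f = cong (f (g zero) +_)
  (trans (∑-tabulate n (g ∘ suc) f) (sym (∑-tabulate n suc (f ∘ g))))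

∏-tabulate : {A : Set} (n : ℕ) (g : Fin n → A) (f : A → ℕ) → ∏ (tabulate g) f ≡ ∏ (allFin n) (f ∘ g)
∏-tabulate zero    g f = refl
∏-tabulate (suc n) g f = cong (f (g zero) *_)
  (trans (∏-tabulate n (g ∘ suc) f) (sym (∏-tabulate n suc (f ∘ g))))

∑-allFin-suc : (n : ℕ) (f : Fin (suc n) → ℕ) → ∑ (allFin (suc n)) f ≡ f zero + ∑ (allFin n) (f ∘ suc)
∑-allFin-suc n f = cong (f zero +_) (∑-tabulate n suc f)

length-allFin : (n : ℕ) → length (allFin n) ≡ n
length-allFin n = length-tabulate (λ i → i)

-- The distributive law: a weighted count of all functions splits into one independent factor per
-- argument. Applied twice, it evaluates weighted counts of tables.
∑-allFuns : {A : Set} (m : ℕ) (xs : List A) (w : Fin m → A → ℕ) →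
  ∑ (allFuns m xs) (λ f → ∏ (allFin m) (λ i → w i (f i))) ≡ ∏ (allFin m) (λ i → ∑ xs (w i))
∑-allFuns zero    xs w = refl
∑-allFuns (suc m) xs w = begin
  ∑ (allFuns (suc m) xs) W
    ≡⟨ ∑-concatMap xs _ W ⟩
  ∑ xs (λ a → ∑ (map (consF a) (allFuns m xs)) W)
    ≡⟨ ∑-cong xs (λ a → ∑-map (allFuns m xs) (consF a) W) ⟩
  ∑ xs (λ a → ∑ (allFuns m xs) (λ g → W (consF a g)))
    ≡⟨ ∑-cong xs (λ a → ∑-cong (allFuns m xs) λ g → cong (w zero a *_) (∏-tabulate m suc _)) ⟩
  ∑ xs (λ a → ∑ (allFuns m xs) (λ g → w zero a * R g))
    ≡⟨ ∑-cong xs (λ a → ∑-* (allFuns m xs) (w zero a) R) ⟩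
  ∑ xs (λ a → w zero a * ∑ (allFuns m xs) R)
    ≡⟨ ∑-cong xs (λ a → trans (cong (w zero a *_) (∑-allFuns m xs (w ∘ suc))) (*-comm (w zero a) _)) ⟩
  ∑ xs (λ a → ∏ (allFin m) (λ i → ∑ xs (w (suc i))) * w zero a)
    ≡⟨ ∑-* xs (∏ (allFin m) (λ i → ∑ xs (w (suc i)))) (w zero) ⟩
  ∏ (allFin m) (λ i → ∑ xs (w (suc i))) * ∑ xs (w zero)
    ≡⟨ *-comm _ (∑ xs (w zero)) ⟩
  ∑ xs (w zero) * ∏ (allFin m) (λ i → ∑ xs (w (suc i)))
    ≡⟨ cong (∑ xs (w zero) *_) (sym (∏-tabulate m suc (λ i → ∑ xs (w i)))) ⟩
  ∏ (allFin (suc m)) (λ i → ∑ xs (w i)) ∎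
  where
  open ≡-Reasoning
  W = λ f → ∏ (allFin (suc m)) (λ i → w i (f i))
  R = λ g → ∏ (allFin m) (λ i → w (suc i) (g i))

-- Indicators, and sums over pairs and triples

abstract
  -- The indicator of `a < b`, so that violating pairs and triples are counted by sums. `abstract`
  -- keeps the test folded; reasoning goes through the lemmas below.
  lt : ℕ → ℕ → ℕ
  lt a b = if a <ᵇ b then 1 else 0

  lt≡1 : ∀ {a b} → a < b → lt a b ≡ 1
  lt≡1 {a} {b} p with a <ᵇ b in eq
  ... | true  = refl
  ... | false = ⊥-elim (subst T eq (<⇒<ᵇ p))

  lt≡0 : ∀ {a b} → ¬ (a < b) → lt a b ≡ 0
  lt≡0 {a} {b} p with a <ᵇ b in eq
  ... | true  = ⊥-elim (p (<ᵇ⇒< a b (subst T (sym eq) _)))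
  ... | false = refl

  lt≤1 : ∀ a b → lt a b ≤ 1
  lt≤1 a b with a <ᵇ b
  ... | true  = ≤-refl
  ... | false = z≤n

lt-elim : ∀ {a b k} → (a < b → 1 ≤ k) → lt a b ≤ k
lt-elim {a} {b} h with a <? b
... | yes p = ≤-trans (lt≤1 a b) (h p)
... | no ¬p = ≤-trans (≤-reflexive (lt≡0 ¬p)) z≤n

lt≥1 : ∀ {a b} → a < b → 1 ≤ lt a b
lt≥1 p = ≤-reflexive (sym (lt≡1 p))

lt-mono : ∀ {a b c d} → (a < b → c < d) → lt a b ≤ lt c d
lt-mono h = lt-elim (λ p → lt≥1 (h p))

markov : ∀ k x → suc k * lt k x ≤ x
markov k x with k <? x
... | yes p = ≤-trans (≤-reflexive (trans (cong (suc k *_) (lt≡1 p)) (*-identityʳ (suc k)))) p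
... | no ¬p = ≤-trans (≤-reflexive (trans (cong (suc k *_) (lt≡0 ¬p)) (*-zeroʳ (suc k)))) z≤n

∑² : {A : Set} → List A → (A → A → ℕ) → ℕ
∑² V f = ∑ V (λ x → ∑ V (f x))

∑³ : {A : Set} → List A → (A → A → A → ℕ) → ℕ
∑³ V f = ∑ V (λ x → ∑² V (f x))

module _ {A : Set} (V : List A) where

  ∑²-mono : {f g : A → A → ℕ} → (∀ x y → f x y ≤ g x y) → ∑² V f ≤ ∑² V g
  ∑²-mono h = ∑-mono V (λ x → ∑-mono V (h x))

  ∑²-cong : {f g : A → A → ℕ} → (∀ x y → f x y ≡ g x y) → ∑² V f ≡ ∑² V g
  ∑²-cong h = ∑-cong V (λ x → ∑-cong V (h x))

  ∑²-+ : (f g : A → A → ℕ) → ∑² V (λ x y → f x y + g x y) ≡ ∑² V f + ∑² V g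
  ∑²-+ f g = trans (∑-cong V (λ x → ∑-+ V (f x) (g x))) (∑-+ V _ _)

  ∑²-* : (c : ℕ) (f : A → A → ℕ) → ∑² V (λ x y → c * f x y) ≡ c * ∑² V f
  ∑²-* c f = trans (∑-cong V (λ x → ∑-* V c (f x))) (∑-* V c _)

  ∑²-swap : (f : A → A → ℕ) → ∑² V f ≡ ∑² V (λ x y → f y x)
  ∑²-swap f = ∑-swap V V f

  ∑²-const : (c : ℕ) → ∑² V (λ _ _ → c) ≡ length V * (length V * c)
  ∑²-const c = trans (∑-cong V (λ _ → ∑-const V c)) (∑-const V _)

  ∑³-mono : {f g : A → A → A → ℕ} → (∀ x y z → f x y z ≤ g x y z) → ∑³ V f ≤ ∑³ V g
  ∑³-mono h = ∑-mono V (λ x → ∑²-mono (h x))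

  ∑³-cong : {f g : A → A → A → ℕ} → (∀ x y z → f x y z ≡ g x y z) → ∑³ V f ≡ ∑³ V g
  ∑³-cong h = ∑-cong V (λ x → ∑²-cong (h x))

  ∑³-+ : (f g : A → A → A → ℕ) → ∑³ V (λ x y z → f x y z + g x y z) ≡ ∑³ V f + ∑³ V g
  ∑³-+ f g = trans (∑-cong V (λ x → ∑²-+ (f x) (g x))) (∑-+ V _ _)

  ∑³-swap₁₂ : (f : A → A → A → ℕ) → ∑³ V f ≡ ∑³ V (λ x y z → f y x z)
  ∑³-swap₁₂ f = ∑-swap V V _

  ∑³-swap₂₃ : (f : A → A → A → ℕ) → ∑³ V f ≡ ∑³ V (λ x y z → f x z y)
  ∑³-swap₂₃ f = ∑-cong V (λ x → ∑²-swap (f x))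

-- Greedy choice of landmarks

module _ {A : Set} where

  sup : (A → ℕ) → List A → ℕ
  sup f []       = 0
  sup f (x ∷ xs) = f x ⊔ sup f xs

  sup-≤ : {f : A → ℕ} {c : ℕ} → (∀ x → f x ≤ c) → (xs : List A) → sup f xs ≤ c
  sup-≤ h []       = z≤n
  sup-≤ h (x ∷ xs) = ⊔-lub (h x) (sup-≤ h xs)

  sup-≤-All : {f : A → ℕ} {c : ℕ} {xs : List A} → All (λ x → f x ≤ c) xs → sup f xs ≤ c
  sup-≤-All []       = z≤n
  sup-≤-All (h ∷ hs) = ⊔-lub h (sup-≤-All hs)

  sup-cong : {f g : A → ℕ} → (∀ x → f x ≡ g x) → (xs : List A) → sup f xs ≡ sup g xs
  sup-cong h []       = refl
  sup-cong h (x ∷ xs) = cong₂ _⊔_ (h x) (sup-cong h xs)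

m+n<o⇒n<o∸m : ∀ m n {o} → m + n < o → n < o ∸ m
m+n<o⇒n<o∸m m n {o} p = m+n≤o⇒m≤o∸n (suc n) (subst (_< o) (+-comm m n) p)

n<o∸m⇒m+n<o : ∀ m n {o} → n < o ∸ m → m + n < o
n<o∸m⇒m+n<o m n {o} p = ≰⇒> λ q → <⇒≱ p (m≤n+o⇒m∸n≤o o m q)

lt-⊔ : ∀ d a b → lt d (a ⊔ b) ≤ lt d a + lt d b
lt-⊔ d a b = lt-elim λ p → helper p (⊔-sel a b)
  where
  helper : d < a ⊔ b → _ → 1 ≤ lt d a + lt d b
  helper p (inj₁ eq) = ≤-trans (lt≥1 (subst (d <_) eq p)) (m≤m+n _ _)
  helper p (inj₂ eq) = ≤-trans (lt≥1 (subst (d <_) eq p)) (m≤n+m _ _)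

lt-sup : {A : Set} (d : ℕ) (f : A → ℕ) (xs : List A) → lt d (sup f xs) ≤ ∑ xs (λ x → lt d (f x))
lt-sup d f []       = ≤-reflexive (lt≡0 {d} {0} λ ())
lt-sup d f (x ∷ xs) = ≤-trans (lt-⊔ d (f x) _) (+-monoʳ-≤ _ (lt-sup d f xs))

+lt≤⊔ : ∀ a b → a + lt a b ≤ b ⊔ a
+lt≤⊔ a b with a <? b
... | yes p = ≤-trans (≤-reflexive (trans (cong (a +_) (lt≡1 p)) (+-comm a 1))) (≤-trans p (m≤m⊔n b a))
... | no ¬p = ≤-trans (≤-reflexive (trans (cong (a +_) (lt≡0 ¬p)) (+-identityʳ a))) (m≤n⊔m b a)

∑²-bound : ∀ n {r} {f : Fin n → Fin n → ℕ} → (∀ x y → f x y ≤ r) → ∑² (allFin n) f ≤ n * (n * r)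
∑²-bound n {r} h = ≤-trans (∑²-mono (allFin n) h)
  (≤-reflexive (trans (∑²-const (allFin n) r) (cong (λ k → k * (k * r)) (length-allFin n))))

∑²-∑-swap : {A B : Set} (V : List A) (xs : List B) (h : B → A → A → ℕ) →
  ∑² V (λ y z → ∑ xs (λ l → h l y z)) ≡ ∑ xs (λ l → ∑² V (h l))
∑²-∑-swap V xs h = trans (∑-cong V (λ y → ∑-swap V xs (λ z l → h l y z))) (∑-swap V xs _)

-- Keep adding an element whose gain exceeds its price p: the total ∑² φ grows by at least the
-- gain and never exceeds n² r, so this stops and the prices paid are bounded by n² r.
module Greedy {n r : ℕ} {A : Set} (enc : Fin n → A) (c : A → Fin n → Fin n → ℕ)
  (c≤r : ∀ l x y → c l x y ≤ r) (p : A → ℕ) where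

  V = allFin n

  φ : List A → Fin n → Fin n → ℕ
  φ ls x y = sup (λ l → c l x y) ls

  gain : List A → A → ℕ
  gain ls l = ∑² V (λ x y → lt (φ ls x y) (c l x y))

  Φ≤ : ∀ ls → ∑² V (φ ls) ≤ n * (n * r)
  Φ≤ ls = ∑²-bound n (λ x y → sup-≤ (λ l → c≤r l x y) ls)

  Φ-step : ∀ l ls → gain ls l + ∑² V (φ ls) ≤ ∑² V (φ (l ∷ ls))
  Φ-step l ls = ≤-trans (≤-reflexive (trans (+-comm (gain ls l) _) (sym (∑²-+ V _ _))))
    (∑²-mono V λ x y → +lt≤⊔ (φ ls x y) (c l x y))

  -- The last component records that the landmarks are genuine rows of the metric, which makes the
  -- triangle inequality available for them.
  Result : Set
  Result = ∃[ ls ] ∑ ls (λ l → suc (p l)) ≤ n * (n * r) × (∀ i → gain ls (enc i) ≤ p (enc i))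
    × All (λ l → ∃[ i ] l ≡ enc i) ls

  -- The fuel always exceeds what `∑² φ` can still grow, and an accepted element raises `∑² φ` by at
  -- least 1, so the fuel cannot run out before the search stops.
  search : ∀ fuel ls → All (λ l → ∃[ i ] l ≡ enc i) ls → ∑ ls (λ l → suc (p l)) ≤ ∑² V (φ ls) → n * (n * r) < ∑² V (φ ls) + fuel → Result
  search zero ls im inv bound =
    ⊥-elim (<⇒≱ (subst (n * (n * r) <_) (+-identityʳ _) bound) (Φ≤ ls))
  search (suc fuel) ls im inv bound with any? (λ i → p (enc i) <? gain ls (enc i))
  ... | no ¬q = ls , ≤-trans inv (Φ≤ ls) , (λ i → ≮⇒≥ (λ q → ¬q (i , q))) , im
  ... | yes (i , q) = search fuel (enc i ∷ ls) ((i , refl) ∷ im)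
    (≤-trans (+-mono-≤ q inv) (Φ-step (enc i) ls))
    (≤-trans bound (≤-trans (≤-reflexive (+-suc _ fuel))
      (+-monoˡ-≤ fuel (≤-trans (+-monoˡ-≤ _ (≤-trans (s≤s z≤n) q)) (Φ-step (enc i) ls)))))

  greedy : Result
  greedy = search (suc (n * (n * r))) [] [] z≤n (m≤n+m _ _)

-- Lower bounds forced by landmarks

Landmark : ℕ → ℕ → Set
Landmark n r = Fin n × Vec (Fin r) n

row : ∀ {n r} → Landmark n r → Fin n → ℕ
row l x = suc (toℕ (Vec.lookup (proj₂ l) x))

-- The lower bound on d y z forced by d x y = B x y and d x z = ρ z, or d x z = B x z and d x y = ρ y.
via : ∀ {n} → (Fin n → Fin n → ℕ) → Fin n → (Fin n → ℕ) → Fin n → Fin n → ℕ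
via B x ρ y z = (B x y ∸ ρ z) ⊔ (B x z ∸ ρ y)

lower : ∀ {n r} → (Fin n → Fin n → ℕ) → (Landmark n r → Fin n → ℕ) → List (Landmark n r) → Fin n → Fin n → ℕ
lower B G ls y z = sup (λ l → via B (proj₁ l) (G l) y z) ls

lower-sym : ∀ {n r} (B : Fin n → Fin n → ℕ) (G : Landmark n r → Fin n → ℕ) ls y z →
  lower B G ls y z ≡ lower B G ls z y
lower-sym B G ls y z = sup-cong (λ l → ⊔-comm (B (proj₁ l) y ∸ G l z) _) ls

module Stage {n r : ℕ} (D B : Fin n → Fin n → ℕ) (D-sym : ∀ x y → D x y ≡ D y x)
  (B≤r : ∀ x y → B x y ≤ r) (rows : Fin n → Vec (Fin r) n) (G : Landmark n r → Fin n → ℕ) (γ k : ℕ) where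

  V = allFin n

  g : Fin n → Fin n → ℕ
  g x = G (x , rows x)

  viol : Landmark n r → ℕ
  viol l = ∑² V (λ y z → lt (D y z) (via B (proj₁ l) (G l) y z))

  via≤r : ∀ l y z → via B (proj₁ l) (G l) y z ≤ r
  via≤r l@(x , _) y z = ⊔-lub (≤-trans (m∸n≤m _ (G l z)) (B≤r x y)) (≤-trans (m∸n≤m _ (G l y)) (B≤r x z))

  open Greedy (λ x → x , rows x) (λ l → via B (proj₁ l) (G l)) via≤r (λ l → γ + k * viol l)
    using (greedy; gain)

  -- The factor 2 comes from the two arguments of `_⊔_` in `via`, which the symmetry of `D`
  -- exchanges.
  ∑viol≤ : ∑ V (λ x → viol (x , rows x)) ≤ 2 * ∑³ V (λ x y z → lt (g x z + D y z) (B x y))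
  ∑viol≤ = begin
    ∑³ V (λ x y z → lt (D y z) (via B x (g x) y z))
      ≤⟨ ∑³-mono V (λ x y z → ≤-trans (lt-⊔ (D y z) _ _)
           (+-mono-≤ (lt-mono (n<o∸m⇒m+n<o (g x z) (D y z))) (lt-mono (n<o∸m⇒m+n<o (g x y) (D y z))))) ⟩
    ∑³ V (λ x y z → lt (g x z + D y z) (B x y) + lt (g x y + D y z) (B x z))
      ≡⟨ ∑³-+ V _ _ ⟩
    V₀ + ∑³ V (λ x y z → lt (g x y + D y z) (B x z))
      ≡⟨ cong (V₀ +_) (trans (∑³-swap₂₃ V _) (∑³-cong V λ x y z → cong (λ t → lt (g x z + t) (B x y)) (D-sym z y))) ⟩
    V₀ + V₀
      ≡⟨ cong (V₀ +_) (sym (+-identityʳ V₀)) ⟩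
    2 * V₀ ∎
    where
    open ≤-Reasoning
    V₀ = ∑³ V (λ x y z → lt (g x z + D y z) (B x y))

  -- The price `γ + k * viol` is split: its part `γ` bounds the number of landmarks, its part
  -- `k * viol` bounds the pairs where the combined bound exceeds `D`. When the search stops, no row
  -- gains more than its price; summed over all rows, this bounds the triples that are still
  -- incompatible after `D y z` has been replaced by the computable `lower`.
  stage : ∃[ ls ] length ls * suc γ ≤ n * (n * r)
    × k * ∑² V (λ y z → lt (D y z) (lower B G ls y z)) ≤ n * (n * r)
    × ∑³ V (λ x y z → lt (g x z + lower B G ls y z) (B x y))
        ≤ n * γ + k * (2 * ∑³ V (λ x y z → lt (g x z + D y z) (B x y)))
  stage with greedy
  ... | ls , paid , done , _ = ls , few , rare , compat
    where
    open ≤-Reasoning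
    few : length ls * suc γ ≤ n * (n * r)
    few = begin
      length ls * suc γ                     ≡⟨ sym (∑-const ls (suc γ)) ⟩
      ∑ ls (λ _ → suc γ)                    ≤⟨ ∑-mono ls (λ l → s≤s (m≤m+n γ _)) ⟩
      ∑ ls (λ l → suc (γ + k * viol l))     ≤⟨ paid ⟩
      n * (n * r) ∎
    rare : k * ∑² V (λ y z → lt (D y z) (lower B G ls y z)) ≤ n * (n * r)
    rare = begin
      k * ∑² V (λ y z → lt (D y z) (lower B G ls y z))
        ≤⟨ *-monoʳ-≤ k (∑²-mono V λ y z → lt-sup (D y z) _ ls) ⟩
      k * ∑² V (λ y z → ∑ ls (λ l → lt (D y z) (via B (proj₁ l) (G l) y z)))
        ≡⟨ cong (k *_) (∑²-∑-swap V ls _) ⟩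
      k * ∑ ls viol                         ≡⟨ sym (∑-* ls k viol) ⟩
      ∑ ls (λ l → k * viol l)               ≤⟨ ∑-mono ls (λ l → m≤n+m _ (suc γ)) ⟩
      ∑ ls (λ l → suc (γ + k * viol l))     ≤⟨ paid ⟩
      n * (n * r) ∎
    compat : ∑³ V (λ x y z → lt (g x z + lower B G ls y z) (B x y))
        ≤ n * γ + k * (2 * ∑³ V (λ x y z → lt (g x z + D y z) (B x y)))
    compat = begin
      ∑³ V (λ x y z → lt (g x z + lower B G ls y z) (B x y))
        ≤⟨ ∑³-mono V (λ x y z → lt-mono λ q → ≤-trans (m+n<o⇒n<o∸m (g x z) _ q) (m≤m⊔n _ _)) ⟩
      ∑ V (λ x → gain ls (x , rows x))      ≤⟨ ∑-mono V done ⟩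
      ∑ V (λ x → γ + k * viol (x , rows x)) ≡⟨ ∑-+ V _ _ ⟩
      ∑ V (λ _ → γ) + ∑ V (λ x → k * viol (x , rows x))
        ≡⟨ cong₂ _+_ (trans (∑-const V γ) (cong (_* γ) (length-allFin n))) (∑-* V k _) ⟩
      n * γ + k * ∑ V (λ x → viol (x , rows x))
        ≤⟨ +-monoʳ-≤ (n * γ) (*-monoʳ-≤ k ∑viol≤) ⟩
      n * γ + k * (2 * ∑³ V (λ x y z → lt (g x z + D y z) (B x y))) ∎

-- Deletion of long pairs

∑-mono-∈ : {A : Set} (xs : List A) {f g : A → ℕ} → (∀ {x} → x ∈ xs → f x ≤ g x) → ∑ xs f ≤ ∑ xs g
∑-mono-∈ []       h = z≤n
∑-mono-∈ (x ∷ xs) h = +-mono-≤ (h (here refl)) (∑-mono-∈ xs (λ p → h (there p)))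

∈⇒↭ : {A : Set} {x : A} {xs : List A} → x ∈ xs → ∃[ ys ] xs ↭ x ∷ ys
∈⇒↭ p with ∈-∃++ p
... | us , ws , refl = us ++ ws , shift _ us ws

∑²-↭ : {A : Set} {xs ys : List A} (f : A → A → ℕ) → xs ↭ ys → ∑² xs f ≡ ∑² ys f
∑²-↭ {xs = xs} f p = trans (∑-cong xs (λ x → ∑-↭ (f x) p)) (∑-↭ _ p)

∑²-∷ : {A : Set} (x : A) (xs : List A) (f : A → A → ℕ) →
  ∑² (x ∷ xs) f ≡ f x x + (∑ xs (f x) + ∑ xs (λ y → f y x)) + ∑² xs f
∑²-∷ x xs f = trans (cong (f x x + ∑ xs (f x) +_) (∑-+ xs (λ y → f y x) _))
  (shuffle (f x x) (∑ xs (f x)) (∑ xs (λ y → f y x)) (∑² xs f))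
  where
  shuffle : ∀ a b c d → (a + b) + (c + d) ≡ a + (b + c) + d
  shuffle = solve-∀

-- As in the proof of Mantel's theorem: a pair x y with s x y > m is deleted together with both ends,
-- because s x z + s y z ≤ 2m for all but κ of the remaining z; a vertex in no such pair is deleted alone.
module Mantel {A : Set} (s β : A → A → ℕ) (s-sym : ∀ x y → s x y ≡ s y x) (m R κ : ℕ)
  (s≤R : ∀ x y → s x y ≤ R) where

  bad : A → A → A → ℕ
  bad x y z = lt (suc (3 * m)) (s x y + (s x z + s y z))

  -- The loss allowed per deleted vertex: `4 * R` for the diagonal entries and the pair itself,
  -- `4 * (R * κ)` for the exceptional third points of a deleted pair, counted in both orders.
  W : ℕ
  W = 4 * R + 4 * (R * κ)

  -- `β` marks the pairs that are given up: where it is 1 the first alternative holds trivially, as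
  -- `s` is at most `R`. Both alternatives survive passing to a sublist, which the induction needs.
  Fine : List A → Set
  Fine V = ∀ x y → s x y ≤ m + R * β x y ⊎ ∑ V (bad x y) ≤ κ

  ∑²-∷-sym : ∀ x xs → ∑² (x ∷ xs) s ≡ s x x + 2 * ∑ xs (s x) + ∑² xs s
  ∑²-∷-sym x xs = trans (∑²-∷ x xs s) (cong (λ t → s x x + t + ∑² xs s)
    (cong (∑ xs (s x) +_) (trans (∑-cong xs (λ y → s-sym y x)) (sym (+-identityʳ _)))))

  pair-bound : ∀ x y z → m < s x y → s x z + s y z ≤ 2 * m + (2 * R) * bad x y z
  pair-bound x y z p with suc (3 * m) <? s x y + (s x z + s y z)
  ... | yes q = begin
    s x z + s y z                  ≤⟨ +-mono-≤ (s≤R x z) (s≤R y z) ⟩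
    R + R                          ≡⟨ double R ⟩
    2 * R * 1                      ≡⟨ cong (2 * R *_) (sym (lt≡1 q)) ⟩
    2 * R * bad x y z              ≤⟨ m≤n+m _ (2 * m) ⟩
    2 * m + 2 * R * bad x y z      ∎
    where
    open ≤-Reasoning
    double : ∀ a → a + a ≡ 2 * a * 1
    double = solve-∀
  -- `s x y` is at least `m + 1`, which absorbs the extra 1 in `3 * m + 1` and leaves exactly
  -- `2 * m` for the other two.
  ... | no ¬q = ≤-trans (+-cancelˡ-≤ (suc m) _ _ (begin
    suc m + (s x z + s y z)        ≤⟨ +-monoˡ-≤ _ p ⟩
    s x y + (s x z + s y z)        ≤⟨ ≮⇒≥ ¬q ⟩
    suc (3 * m)                    ≡⟨ split m ⟩
    suc m + 2 * m                  ∎)) (m≤m+n _ _)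
    where
    open ≤-Reasoning
    split : ∀ a → suc (3 * a) ≡ suc a + 2 * a
    split = solve-∀

  Bound : List A → Set
  Bound V = ∑² V s ≤ m * (length V * length V) + length V * W + 2 * R * ∑² V β

  remove-vertex : ∀ x V → (∀ {y} → y ∈ V → s x y ≤ m + R * β x y) → Bound V → Bound (x ∷ V)
  remove-vertex x V small IH = begin
    ∑² (x ∷ V) s
      ≡⟨ ∑²-∷-sym x V ⟩
    s x x + 2 * ∑ V (s x) + ∑² V s
      ≤⟨ +-mono-≤ (+-mono-≤ (s≤R x x) (*-monoʳ-≤ 2 row-bound)) IH ⟩
    R + 2 * (l * m + R * b) + (m * (l * l) + l * W + 2 * R * B)
      ≤⟨ m≤m+n _ _ ⟩
    R + 2 * (l * m + R * b) + (m * (l * l) + l * W + 2 * R * B) + (m + (3 * R + 4 * (R * κ)))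
      ≡⟨ collect m R κ l b B ⟩
    m * (suc l * suc l) + suc l * W + 2 * R * (b + B)
      ≤⟨ +-monoʳ-≤ _ (*-monoʳ-≤ (2 * R) β-bound) ⟩
    m * (suc l * suc l) + suc l * W + 2 * R * ∑² (x ∷ V) β ∎
    where
    open ≤-Reasoning
    l = length V
    b = ∑ V (β x)
    B = ∑² V β
    row-bound : ∑ V (s x) ≤ l * m + R * b
    row-bound = begin
      ∑ V (s x)                         ≤⟨ ∑-mono-∈ V small ⟩
      ∑ V (λ y → m + R * β x y)         ≡⟨ ∑-+ V _ _ ⟩
      ∑ V (λ _ → m) + ∑ V (λ y → R * β x y) ≡⟨ cong₂ _+_ (∑-const V m) (∑-* V R (β x)) ⟩
      l * m + R * b                     ∎
    β-bound : b + B ≤ ∑² (x ∷ V) β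
    β-bound = +-mono-≤ (m≤n+m b (β x x)) (∑-mono V (λ y → m≤n+m _ (β y x)))
    collect : ∀ m R κ l b B →
      R + 2 * (l * m + R * b) + (m * (l * l) + l * (4 * R + 4 * (R * κ)) + 2 * R * B) + (m + (3 * R + 4 * (R * κ)))
      ≡ m * (suc l * suc l) + suc l * (4 * R + 4 * (R * κ)) + 2 * R * (b + B)
    collect = solve-∀

  remove-pair : ∀ x y V → m < s x y → ∑ V (bad x y) ≤ κ → Bound V → Bound (x ∷ y ∷ V)
  remove-pair x y V big few IH = begin
    ∑² (x ∷ y ∷ V) s
      ≡⟨ ∑²-∷-sym x (y ∷ V) ⟩
    s x x + 2 * (s x y + ∑ V (s x)) + ∑² (y ∷ V) s
      ≡⟨ cong (s x x + 2 * (s x y + ∑ V (s x)) +_) (∑²-∷-sym y V) ⟩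
    s x x + 2 * (s x y + ∑ V (s x)) + (s y y + 2 * ∑ V (s y) + ∑² V s)
      ≡⟨ regroup (s x x) (s x y) (∑ V (s x)) (s y y) (∑ V (s y)) (∑² V s) ⟩
    s x x + s y y + 2 * s x y + 2 * (∑ V (s x) + ∑ V (s y)) + ∑² V s
      ≤⟨ +-mono-≤ (+-mono-≤ (+-mono-≤ (+-mono-≤ (s≤R x x) (s≤R y y)) (*-monoʳ-≤ 2 (s≤R x y)))
           (*-monoʳ-≤ 2 rows-bound)) IH ⟩
    R + R + 2 * R + 2 * (l * (2 * m) + 2 * R * κ) + (m * (l * l) + l * W + 2 * R * B)
      ≤⟨ m≤m+n _ _ ⟩
    R + R + 2 * R + 2 * (l * (2 * m) + 2 * R * κ) + (m * (l * l) + l * W + 2 * R * B) + (4 * m + W)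
      ≡⟨ collect m R κ l B ⟩
    m * ((2 + l) * (2 + l)) + (2 + l) * W + 2 * R * B
      ≤⟨ +-monoʳ-≤ _ (*-monoʳ-≤ (2 * R) β-bound) ⟩
    m * ((2 + l) * (2 + l)) + (2 + l) * W + 2 * R * ∑² (x ∷ y ∷ V) β ∎
    where
    open ≤-Reasoning
    l = length V
    B = ∑² V β
    rows-bound : ∑ V (s x) + ∑ V (s y) ≤ l * (2 * m) + 2 * R * κ
    rows-bound = begin
      ∑ V (s x) + ∑ V (s y)                       ≡⟨ sym (∑-+ V (s x) (s y)) ⟩
      ∑ V (λ z → s x z + s y z)                   ≤⟨ ∑-mono V (λ z → pair-bound x y z big) ⟩
      ∑ V (λ z → 2 * m + 2 * R * bad x y z)       ≡⟨ ∑-+ V _ _ ⟩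
      ∑ V (λ _ → 2 * m) + ∑ V (λ z → 2 * R * bad x y z)
        ≡⟨ cong₂ _+_ (∑-const V (2 * m)) (∑-* V (2 * R) (bad x y)) ⟩
      l * (2 * m) + 2 * R * ∑ V (bad x y)         ≤⟨ +-monoʳ-≤ _ (*-monoʳ-≤ (2 * R) few) ⟩
      l * (2 * m) + 2 * R * κ                     ∎
    β-bound : B ≤ ∑² (x ∷ y ∷ V) β
    β-bound = ≤-trans (∑-mono V (λ z → ≤-trans (m≤n+m (∑ V (β z)) (β z y)) (m≤n+m _ (β z x))))
      (≤-trans (m≤n+m _ (∑ (x ∷ y ∷ V) (β y))) (m≤n+m _ (∑ (x ∷ y ∷ V) (β x))))
    regroup : ∀ a b c d e f → a + 2 * (b + c) + (d + 2 * e + f) ≡ a + d + 2 * b + 2 * (c + e) + f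
    regroup = solve-∀
    collect : ∀ m R κ l B →
      R + R + 2 * R + 2 * (l * (2 * m) + 2 * R * κ) + (m * (l * l) + l * (4 * R + 4 * (R * κ)) + 2 * R * B)
        + (4 * m + (4 * R + 4 * (R * κ)))
      ≡ m * ((2 + l) * (2 + l)) + (2 + l) * (4 * R + 4 * (R * κ)) + 2 * R * B
    collect = solve-∀

  -- The recursion is on the length, because the partner of `x` may sit anywhere in the list, and
  -- what remains after deleting both is known only up to permutation.
  bound : ∀ fuel V → length V ≤ fuel → Fine V → Bound V
  bound _ [] _ _ = z≤n
  bound (suc fuel) (x ∷ V) (s≤s len) fine
    -- Testing against `m + R * β x y` instead of `m` ensures that a marked pair is never deleted as
    -- a long one.
    with Any.any? (λ y → ¬? (s x y ≤? m + R * β x y)) V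
  ... | no none = remove-vertex x V
    (λ p → decidable-stable (_ ≤? _) (λ q → none (lose p q)))
    (bound fuel V len λ a b → weaken (fine a b))
    where
    weaken : ∀ {a b} → s a b ≤ m + R * β a b ⊎ ∑ (x ∷ V) (bad a b) ≤ κ →
      s a b ≤ m + R * β a b ⊎ ∑ V (bad a b) ≤ κ
    weaken (inj₁ p) = inj₁ p
    weaken (inj₂ p) = inj₂ (≤-trans (m≤n+m _ _) p)
  ... | yes some with find some
  ... | y , y∈V , big with ∈⇒↭ y∈V
  ... | V′ , perm = resp (remove-pair x y V′ (≤-trans (s≤s (m≤m+n m _)) (≰⇒> big)) few
      (bound fuel V′ (≤-trans (n≤1+n _) (subst (_≤ fuel) (↭-length perm) len)) λ a b → weaken (fine a b)))
    where
    shrink : ∀ f → ∑ V′ f ≤ ∑ (x ∷ V) f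
    shrink f = ≤-trans (m≤n+m _ (f y)) (≤-trans (≤-reflexive (sym (∑-↭ f perm))) (m≤n+m _ (f x)))
    weaken : ∀ {a b} → s a b ≤ m + R * β a b ⊎ ∑ (x ∷ V) (bad a b) ≤ κ →
      s a b ≤ m + R * β a b ⊎ ∑ V′ (bad a b) ≤ κ
    weaken (inj₁ p) = inj₁ p
    weaken (inj₂ p) = inj₂ (≤-trans (shrink _) p)
    few : ∑ V′ (bad x y) ≤ κ
    few with fine x y
    ... | inj₁ p = ⊥-elim (big p)
    ... | inj₂ p = ≤-trans (shrink _) p
    resp : Bound (x ∷ y ∷ V′) → Bound (x ∷ V)
    resp h rewrite ∑²-↭ s (↭.prep x perm) | ∑²-↭ β (↭.prep x perm) | ↭-length perm = h

-- Certificates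

-- Landmarks for the upper bounds and for the two passes of lower bounds. All intervals are computed
-- from these lists alone, so a bound on the number of certificates bounds the number of systems of
-- intervals.
Certificate : ℕ → ℕ → Set
Certificate n r = List (Landmark n r) × List (Landmark n r) × List (Landmark n r)

module _ {n r : ℕ} where

  -- The minimum of `r` and all sums `row l x + row l y`, written as a complement in `r`, so that
  -- the greedy search, which raises a supremum, applies.
  upper : List (Landmark n r) → Fin n → Fin n → ℕ
  upper Z x y = r ∸ sup (λ l → r ∸ (row l x + row l y)) Z

  upper≤r : ∀ Z x y → upper Z x y ≤ r
  upper≤r Z x y = m∸n≤m r (sup (λ l → r ∸ (row l x + row l y)) Z)

  lower₁ : Certificate n r → Fin n → Fin n → ℕ
  lower₁ (Z , T , _) = lower (upper Z) row T

  lower₂ : Certificate n r → Fin n → Fin n → ℕ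
  lower₂ c@(Z , _ , T′) = lower (upper Z) (λ l → lower₁ c (proj₁ l)) T′

  hi lo size : Certificate n r → Fin n → Fin n → ℕ
  hi (Z , _) = upper Z
  lo c x y = lower₁ c x y ⊔ lower₂ c x y
  size c x y = suc (hi c x y) ∸ lo c x y

  hi-sym : ∀ c x y → hi c x y ≡ hi c y x
  hi-sym (Z , _) x y = cong (r ∸_) (sup-cong (λ l → cong (r ∸_) (+-comm (row l x) (row l y))) Z)

  lo-sym : ∀ c x y → lo c x y ≡ lo c y x
  lo-sym c@(Z , T , T′) x y = cong₂ _⊔_ (lower-sym (upper Z) row T x y) (lower-sym (upper Z) (λ l → lower₁ c (proj₁ l)) T′ x y)

  size-sym : ∀ c x y → size c x y ≡ size c y x
  size-sym c x y = cong₂ (λ a b → suc a ∸ b) (hi-sym c x y) (lo-sym c x y)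

floor : ∀ N H → 1 ≤ H → ∃[ γ ] H * γ ≤ N × N ≤ H * suc γ
floor N (suc H) _ = N / suc H ,
  ≤-trans (≤-reflexive (*-comm (suc H) _)) (≤-trans (m≤n+m _ (N % suc H)) (≤-reflexive (sym eq))) ,
  ≤-trans (≤-reflexive eq) (≤-trans (+-monoˡ-≤ _ (<⇒≤ (m%n<n N (suc H)))) (≤-reflexive (*-comm (suc (N / suc H)) (suc H))))
  where
  eq = m≡m%n+[m/n]*n N (suc H)

length-bound : ∀ {n r γ} len H → 1 ≤ n → n * n ≤ H * suc γ → len * suc γ ≤ n * (n * r) → len ≤ H * r
length-bound {n@(suc _)} {r} {γ} len H _ p q = *-cancelˡ-≤ (n * n) (begin
  n * n * len              ≤⟨ *-monoˡ-≤ len p ⟩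
  H * suc γ * len          ≡⟨ shuffle H (suc γ) len ⟩
  H * (len * suc γ)        ≤⟨ *-monoʳ-≤ H q ⟩
  H * (n * (n * r))        ≡⟨ regroup H n r ⟩
  n * n * (H * r)          ∎)
  where
  open ≤-Reasoning
  shuffle : ∀ a b c → a * b * c ≡ a * (c * b)
  shuffle = solve-∀
  regroup : ∀ a b c → a * (b * (b * c)) ≡ b * b * (a * c)
  regroup = solve-∀

-- The aᵢ and bᵢ are the end points of three intervals.
triple-bound : ∀ {r m} → r < 2 * m → ∀ b₁ b₂ b₃ a₁ a₂ a₃ → b₁ ≤ r → b₂ ≤ r → b₃ ≤ r →
  a₁ ≤ b₁ → a₂ ≤ b₂ → a₃ ≤ b₃ → b₁ ≤ a₂ + a₃ → b₂ ≤ a₁ + a₃ → b₃ ≤ a₁ + a₂ →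
  suc b₁ ∸ a₁ + (suc b₂ ∸ a₂ + (suc b₃ ∸ a₃)) ≤ suc (3 * m)
triple-bound {r} {m} r<2m b₁ b₂ b₃ a₁ a₂ a₃ u₁ u₂ u₃ l₁ l₂ l₃ t₁ t₂ t₃ =
  ≮⇒≥ λ p → <⇒≱ (twice p) doubled
  where
  open ≤-Reasoning
  s₁ = suc b₁ ∸ a₁
  s₂ = suc b₂ ∸ a₂
  s₃ = suc b₃ ∸ a₃
  S = s₁ + (s₂ + s₃)
  tight : ∀ a b → a ≤ b → suc b ∸ a + a ≡ suc b
  tight a b p = m∸n+n≡m (≤-trans p (n≤1+n b))
  -- Adding the three triangle inequalities gives ∑ b ≤ 2 ∑ a, hence 2 S ≤ ∑ (b + 1) + 3 ≤ 6 m + 3.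
  -- The right side is odd, so S ≤ 3 m + 1.
  doubled : 2 * S ≤ 6 * m + 3
  doubled = +-cancelʳ-≤ (b₁ + b₂ + b₃) _ _ (begin
    2 * S + (b₁ + b₂ + b₃)
      ≤⟨ +-monoʳ-≤ (2 * S) (+-mono-≤ (+-mono-≤ t₁ t₂) t₃) ⟩
    2 * S + (a₂ + a₃ + (a₁ + a₃) + (a₁ + a₂))
      ≡⟨ e₁ s₁ s₂ s₃ a₁ a₂ a₃ ⟩
    2 * ((s₁ + a₁) + (s₂ + a₂) + (s₃ + a₃))
      ≡⟨ cong (2 *_) (cong₂ _+_ (cong₂ _+_ (tight a₁ b₁ l₁) (tight a₂ b₂ l₂)) (tight a₃ b₃ l₃)) ⟩
    2 * (suc b₁ + suc b₂ + suc b₃)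
      ≡⟨ e₂ b₁ b₂ b₃ ⟩
    suc b₁ + suc b₂ + suc b₃ + 3 + (b₁ + b₂ + b₃)
      ≤⟨ +-monoˡ-≤ _ (+-monoˡ-≤ 3 (+-mono-≤ (+-mono-≤ (below u₁) (below u₂)) (below u₃))) ⟩
    2 * m + 2 * m + 2 * m + 3 + (b₁ + b₂ + b₃)
      ≡⟨ e₃ m (b₁ + b₂ + b₃) ⟩
    6 * m + 3 + (b₁ + b₂ + b₃) ∎)
    where
    below : ∀ {b} → b ≤ r → suc b ≤ 2 * m
    below p = ≤-trans (s≤s p) r<2m
    e₁ : ∀ s₁ s₂ s₃ a₁ a₂ a₃ → 2 * (s₁ + (s₂ + s₃)) + (a₂ + a₃ + (a₁ + a₃) + (a₁ + a₂))
      ≡ 2 * ((s₁ + a₁) + (s₂ + a₂) + (s₃ + a₃))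
    e₁ = solve-∀
    e₂ : ∀ a b c → 2 * (suc a + suc b + suc c) ≡ suc a + suc b + suc c + 3 + (a + b + c)
    e₂ = solve-∀
    e₃ : ∀ m t → 2 * m + 2 * m + 2 * m + 3 + t ≡ 6 * m + 3 + t
    e₃ = solve-∀
  twice : suc (3 * m) < S → 6 * m + 3 < 2 * S
  twice p = ≤-trans (≤-reflexive (e m)) (*-monoʳ-≤ 2 p)
    where
    e : ∀ m → suc (6 * m + 3) ≡ 2 * suc (suc (3 * m))
    e = solve-∀

lt-or : ∀ {a b k} → (¬ (a < b) → 1 ≤ k) → 1 ≤ lt a b + k
lt-or {a} {b} {k} h with a <? b
... | yes p = ≤-trans (lt≥1 p) (m≤m+n _ k)
... | no ¬p = ≤-trans (h ¬p) (m≤n+m k _)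

module Container {n r m h : ℕ} (1≤n : 1 ≤ n) (1≤r : 1 ≤ r) (1≤h : 1 ≤ h) (r<2m : r < 2 * m)
  (rows : Fin n → Vec (Fin r) n) where

  V = allFin n

  D : Fin n → Fin n → ℕ
  D x = row (x , rows x)

  D≤r : ∀ x y → D x y ≤ r
  D≤r x y = toℕ<n (Vec.lookup (rows x) y)

  exceptions : Certificate n r → ℕ
  exceptions c = ∑² V (λ x y → lt (D x y) (lo c x y))

  misfit : Certificate n r → Fin n → Fin n → Fin n → ℕ
  misfit c x y z = lt (suc (3 * m)) (size c x y + (size c x z + size c y z))

  K : ℕ
  K = 4 * (h * h * h) * (r * r * r)

  module _ (D-sym : ∀ x y → D x y ≡ D y x) (D-triangle : ∀ x y z → D x y ≤ D z x + D z y) where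

    -- With `λ₀ = h * r` the factor `r` cancels from `λ₀ * e ≤ n * (n * r)`, leaving `h * e ≤ n * n`
    -- for the false pairs. Each pass multiplies incompatible triples by `2 * λ₀`, so the precisions
    -- are fixed backwards: `h` for the last pass, `H₂` for the one before, `H₁` for the upper
    -- bounds. Precision H takes at most H r landmarks, and `K` equals `H₁ * r`, the largest of the
    -- three.
    λ₀ H₁ H₂ : ℕ
    λ₀ = h * r
    H₂ = 2 * λ₀ * h
    H₁ = 2 * λ₀ * H₂

    1≤λ₀ : 1 ≤ λ₀
    1≤λ₀ = *-mono-≤ 1≤h 1≤r

    1≤H₂ : 1 ≤ H₂
    1≤H₂ = *-mono-≤ (*-mono-≤ (s≤s (z≤n {1})) 1≤λ₀) 1≤h

    1≤H₁ : 1 ≤ H₁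
    1≤H₁ = *-mono-≤ (*-mono-≤ (s≤s (z≤n {1})) 1≤λ₀) 1≤H₂

    -- The price is the constant `γ`: by the triangle inequality a row of the metric never gives a
    -- false upper bound, so there is nothing else to charge for.
    upper-stage : ∃[ Z ] length Z ≤ H₁ * r × (∀ x y → D x y ≤ upper Z x y)
      × H₁ * ∑³ V (λ x y z → lt (D x z + D y z) (upper Z x y)) ≤ n * (n * n)
    upper-stage with floor (n * n) H₁ 1≤H₁
    ... | γ , γ≤ , ≤γ with Greedy.greedy {n} {r} (λ x → x , rows x) (λ l x y → r ∸ (row l x + row l y))
                             (λ l x y → m∸n≤m r (row l x + row l y)) (λ _ → γ)
    ... | Z , paid , done , image = Z ,
      length-bound (length Z) H₁ 1≤n ≤γ (≤-trans (≤-reflexive (sym (∑-const Z (suc γ)))) paid) ,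
      above , few
      where
      open ≤-Reasoning
      φ : Fin n → Fin n → ℕ
      φ x y = sup (λ l → r ∸ (row l x + row l y)) Z
      above : ∀ x y → D x y ≤ upper Z x y
      above x y = ≤-trans (≤-reflexive (sym (m∸[m∸n]≡n (D≤r x y))))
        (∸-monoʳ-≤ r (sup-≤-All (All.map (λ { (z , refl) → ∸-monoʳ-≤ r (D-triangle x y z) }) image)))
      -- The stopping rule compares complements in `r`; this turns it back into "the sum at a
      -- candidate is below `upper`".
      flip : ∀ a d → d < r ∸ a → a < r ∸ d
      flip a d p = m+n<o⇒n<o∸m d a (subst (_< r) (+-comm a d) (n<o∸m⇒m+n<o a d p))
      few : H₁ * ∑³ V (λ x y z → lt (D x z + D y z) (upper Z x y)) ≤ n * (n * n)
      few = begin
        H₁ * ∑³ V (λ x y z → lt (D x z + D y z) (upper Z x y))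
          ≡⟨ cong (H₁ *_) (trans (∑³-swap₂₃ V _) (∑³-swap₁₂ V _)) ⟩
        H₁ * ∑³ V (λ x y z → lt (D y x + D z x) (upper Z y z))
          ≤⟨ *-monoʳ-≤ H₁ (∑³-mono V λ x y z → lt-mono λ p →
               flip (φ y z) _ (subst (_< upper Z y z) (cong₂ _+_ (D-sym y x) (D-sym z x)) p)) ⟩
        H₁ * ∑³ V (λ x y z → lt (φ y z) (r ∸ (D x y + D x z)))
          ≤⟨ *-monoʳ-≤ H₁ (∑-bound V done) ⟩
        H₁ * (length V * γ)   ≡⟨ cong (λ k → H₁ * (k * γ)) (length-allFin n) ⟩
        H₁ * (n * γ)          ≡⟨ shuffle H₁ n γ ⟩
        n * (H₁ * γ)          ≤⟨ *-monoʳ-≤ n γ≤ ⟩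
        n * (n * n)           ∎
        where
        shuffle : ∀ a b c → a * (b * c) ≡ b * (a * c)
        shuffle = solve-∀

    rare-bound : ∀ e → λ₀ * e ≤ n * (n * r) → h * e ≤ n * n
    rare-bound e p = *-cancelˡ-≤ r {{>-nonZero 1≤r}}
      (≤-trans (≤-reflexive (e₁ r h e)) (≤-trans p (≤-reflexive (e₂ n r))))
      where
      e₁ : ∀ r h e → r * (h * e) ≡ h * r * e
      e₁ = solve-∀
      e₂ : ∀ n r → n * (n * r) ≡ r * (n * n)
      e₂ = solve-∀

    -- A pass adds n³ of its own, while the error it inherits was made precise to `2 * λ₀ * H`
    -- beforehand and so contributes only its old bound. The upper bounds and the two passes
    -- together give `3 * (n * (n * n))`.
    compose : ∀ H {γ a V V′} → V′ ≤ n * γ + λ₀ * (2 * V) → H * γ ≤ n * n → 2 * λ₀ * H * V ≤ a →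
      H * V′ ≤ n * (n * n) + a
    compose H {γ} {a} {V} {V′} p q v = begin
      H * V′                                ≤⟨ *-monoʳ-≤ H p ⟩
      H * (n * γ + λ₀ * (2 * V))            ≡⟨ e H n γ λ₀ V ⟩
      n * (H * γ) + 2 * λ₀ * H * V          ≤⟨ +-mono-≤ (*-monoʳ-≤ n q) v ⟩
      n * (n * n) + a                       ∎
      where
      open ≤-Reasoning
      e : ∀ H n γ l V → H * (n * γ + l * (2 * V)) ≡ n * (H * γ) + 2 * l * H * V
      e = solve-∀

    certificate : ∃[ c ] (length (proj₁ c) ≤ K × length (proj₁ (proj₂ c)) ≤ K × length (proj₂ (proj₂ c)) ≤ K)
      × (∀ x y → D x y ≤ hi c x y)
      × h * exceptions c ≤ 2 * (n * n)
      × h * ∑³ V (λ x y z → lt (lo c x z + lo c y z) (hi c x y)) ≤ 3 * (n * (n * n))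
    certificate with upper-stage
    ... | Z , lenZ , above , fewZ
      with floor (n * n) H₂ 1≤H₂ | floor (n * n) h 1≤h
    ... | γ₂ , γ₂≤ , ≤γ₂ | γ₃ , γ₃≤ , ≤γ₃
      with Stage.stage D (upper Z) D-sym (upper≤r Z) rows row γ₂ λ₀
    ... | T , lenT , rareT , fewT
      with Stage.stage D (upper Z) D-sym (upper≤r Z) rows
             (λ l → lower (upper Z) row T (proj₁ l)) γ₃ λ₀
    ... | T′ , lenT′ , rareT′ , fewT′ = c ,
        (≤-trans lenZ (≤-reflexive (k₁ h r)) ,
         ≤-trans (length-bound (length T) H₂ 1≤n ≤γ₂ lenT) (≤-trans (m≤m*n (H₂ * r) (2 * λ₀) {{>-nonZero (*-mono-≤ (s≤s (z≤n {1})) 1≤λ₀)}}) (≤-reflexive (k₂ h r))) ,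
         ≤-trans (length-bound (length T′) h 1≤n ≤γ₃ lenT′) (≤-trans (m≤m*n (h * r) (2 * λ₀ * (2 * λ₀)) {{>-nonZero (*-mono-≤ 1≤2λ₀ 1≤2λ₀)}}) (≤-reflexive (k₃ h r)))) ,
        above , rare , few
      where
      open ≤-Reasoning
      c = Z , T , T′
      1≤2λ₀ : 1 ≤ 2 * λ₀
      1≤2λ₀ = *-mono-≤ (s≤s (z≤n {1})) 1≤λ₀
      k₁ : ∀ h r → 2 * (h * r) * (2 * (h * r) * h) * r ≡ 4 * (h * h * h) * (r * r * r)
      k₁ = solve-∀
      k₂ : ∀ h r → 2 * (h * r) * h * r * (2 * (h * r)) ≡ 4 * (h * h * h) * (r * r * r)
      k₂ = solve-∀
      k₃ : ∀ h r → h * r * (2 * (h * r) * (2 * (h * r))) ≡ 4 * (h * h * h) * (r * r * r)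
      k₃ = solve-∀
      E₁ = ∑² V (λ x y → lt (D x y) (lower₁ c x y))
      E₂ = ∑² V (λ x y → lt (D x y) (lower₂ c x y))
      rare : h * exceptions c ≤ 2 * (n * n)
      rare = begin
        h * exceptions c        ≤⟨ *-monoʳ-≤ h (∑²-mono V λ x y → lt-⊔ (D x y) _ _) ⟩
        h * ∑² V (λ x y → lt (D x y) (lower₁ c x y) + lt (D x y) (lower₂ c x y))
                                ≡⟨ cong (h *_) (∑²-+ V _ _) ⟩
        h * (E₁ + E₂)           ≡⟨ *-distribˡ-+ h E₁ E₂ ⟩
        h * E₁ + h * E₂         ≤⟨ +-mono-≤ (rare-bound E₁ rareT) (rare-bound E₂ rareT′) ⟩
        n * n + n * n           ≡⟨ cong (n * n +_) (sym (+-identityʳ (n * n))) ⟩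
        2 * (n * n)             ∎
      -- The first pass replaces `D y z`. Exchanging `x` and `y` moves the remaining `D` into that
      -- position, ready for the second pass.
      V₂ : ∑³ V (λ x y z → lt (lower₁ c x z + D y z) (hi c x y)) ≡ ∑³ V (λ x y z → lt (D x z + lower₁ c y z) (hi c x y))
      V₂ = trans (∑³-swap₁₂ V _) (∑³-cong V λ x y z → cong₂ lt (+-comm (lower₁ c y z) (D x z)) (hi-sym c y x))
      few : h * ∑³ V (λ x y z → lt (lo c x z + lo c y z) (hi c x y)) ≤ 3 * (n * (n * n))
      few = begin
        h * ∑³ V (λ x y z → lt (lo c x z + lo c y z) (hi c x y))
          ≤⟨ *-monoʳ-≤ h (∑³-mono V λ x y z → lt-mono λ p →
               ≤-<-trans (+-mono-≤ (m≤m⊔n (lower₁ c x z) _) (m≤n⊔m (lower₁ c y z) _)) p) ⟩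
        h * ∑³ V (λ x y z → lt (lower₁ c x z + lower₂ c y z) (hi c x y))
          ≤⟨ compose h (subst (λ t → _ ≤ n * γ₃ + λ₀ * (2 * t)) V₂ fewT′) γ₃≤ (compose H₂ fewT γ₂≤ fewZ) ⟩
        n * (n * n) + (n * (n * n) + n * (n * n))
          ≡⟨ e (n * (n * n)) ⟩
        3 * (n * (n * n)) ∎
        where
        e : ∀ a → a + (a + a) ≡ 3 * a
        e = solve-∀

  module _ (c : Certificate n r) (above : ∀ x y → D x y ≤ hi c x y) where

    I E : Fin n → Fin n → Fin n → ℕ
    I x y z = lt (lo c x z + lo c y z) (hi c x y)
    E x y z = lt (D x y) (lo c x y)

    -- If no pair is exceptional, then lo ≤ D ≤ hi makes all three intervals nonempty; if moreover
    -- the interval triangle inequalities hold, `triple-bound` applies. A misfit triple must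
    -- therefore fail one of six conditions.
    misfit-cover : ∀ x y z →
      misfit c x y z ≤ I x y z + (I x z y + (I y z x + (E x y z + (E x z y + (E y z x + 0)))))
    misfit-cover x y z = lt-elim λ big →
      lt-or λ t₃ → lt-or λ t₂ → lt-or λ t₁ → lt-or λ l₃ → lt-or λ l₂ → lt-or λ l₁ →
      ⊥-elim (<⇒≱ big (triple-bound {r} {m} r<2m
        (hi c x y) (hi c x z) (hi c y z) (lo c x y) (lo c x z) (lo c y z)
        (upper≤r (proj₁ c) x y) (upper≤r (proj₁ c) x z) (upper≤r (proj₁ c) y z)
        (≤-trans (≮⇒≥ l₃) (above x y)) (≤-trans (≮⇒≥ l₂) (above x z)) (≤-trans (≮⇒≥ l₁) (above y z))
        (≮⇒≥ t₃)
        (≤-trans (≮⇒≥ t₂) (≤-reflexive (cong (lo c x y +_) (lo-sym c z y))))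
        (≤-trans (≮⇒≥ t₁) (≤-reflexive (cong₂ _+_ (lo-sym c y x) (lo-sym c z x))))))

    ∑misfit : ∑³ V (misfit c) ≤ 3 * ∑³ V I + 3 * (n * exceptions c)
    ∑misfit = begin
      ∑³ V (misfit c)                               ≤⟨ ∑³-mono V misfit-cover ⟩
      ∑³ V (λ x y z → I x y z + (I x z y + (I y z x + (E x y z + (E x z y + (E y z x + 0))))))
        ≡⟨ ∑³-+ V _ _ ⟩
      i + ∑³ V (λ x y z → I x z y + (I y z x + (E x y z + (E x z y + (E y z x + 0)))))
        ≡⟨ cong (i +_) (trans (∑³-+ V _ _) (cong₂ _+_ (rot₁ I) (∑³-+ V _ _))) ⟩
      i + (i + (∑³ V (λ x y z → I y z x) + ∑³ V (λ x y z → E x y z + (E x z y + (E y z x + 0)))))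
        ≡⟨ cong (λ t → i + (i + t)) (cong₂ _+_ (rot₂ I) (trans (∑³-+ V _ _) (cong (e +_) (trans (∑³-+ V _ _)
             (cong₂ _+_ (rot₁ E) (trans (∑³-+ V _ _) (cong₂ _+_ (rot₂ E) ∑³0))))))) ⟩
      i + (i + (i + (e + (e + (e + 0)))))           ≡⟨ collect i e ⟩
      3 * i + 3 * e                                 ≡⟨ cong (λ t → 3 * i + 3 * t) ∑E ⟩
      3 * i + 3 * (n * exceptions c)                ∎
      where
      open ≤-Reasoning
      i = ∑³ V I
      e = ∑³ V E
      rot₁ : ∀ f → ∑³ V (λ x y z → f x z y) ≡ ∑³ V f
      rot₁ f = sym (∑³-swap₂₃ V f)
      rot₂ : ∀ f → ∑³ V (λ x y z → f y z x) ≡ ∑³ V f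
      rot₂ f = trans (∑³-swap₁₂ V (λ x y z → f y z x)) (rot₁ f)
      ∑³0 : ∑³ V (λ _ _ _ → 0) ≡ 0
      ∑³0 = trans (∑-cong V λ _ → trans (∑²-const V 0) (trans (cong (length V *_) (*-zeroʳ (length V))) (*-zeroʳ (length V))))
        (trans (∑-const V 0) (*-zeroʳ (length V)))
      ∑E : e ≡ n * exceptions c
      ∑E = trans (∑²-cong V λ x y → trans (∑-const V _) (cong (_* lt (D x y) (lo c x y)) (length-allFin n)))
        (∑²-* V n _)
      collect : ∀ i e → i + (i + (i + (e + (e + (e + 0))))) ≡ 3 * i + 3 * e
      collect = solve-∀

    -- 15 = 3 · 3 + 3 · 2: three rotations of an incompatible triple, and three choices of an
    -- exceptional pair with a free third point.
    ∑misfit-bound : h * exceptions c ≤ 2 * (n * n) → h * ∑³ V I ≤ 3 * (n * (n * n)) →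
      h * ∑³ V (misfit c) ≤ 15 * (n * (n * n))
    ∑misfit-bound p q = begin
      h * ∑³ V (misfit c)                           ≤⟨ *-monoʳ-≤ h ∑misfit ⟩
      h * (3 * ∑³ V I + 3 * (n * exceptions c))     ≡⟨ e₁ h (∑³ V I) n (exceptions c) ⟩
      3 * (h * ∑³ V I) + 3 * (n * (h * exceptions c))
        ≤⟨ +-mono-≤ (*-monoʳ-≤ 3 q) (*-monoʳ-≤ 3 (*-monoʳ-≤ n p)) ⟩
      3 * (3 * (n * (n * n))) + 3 * (n * (2 * (n * n))) ≡⟨ e₂ n ⟩
      15 * (n * (n * n))                            ∎
      where
      open ≤-Reasoning
      e₁ : ∀ h i n e → h * (3 * i + 3 * (n * e)) ≡ 3 * (h * i) + 3 * (n * (h * e))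
      e₁ = solve-∀
      e₂ : ∀ n → 3 * (3 * (n * (n * n))) + 3 * (n * (2 * (n * n))) ≡ 15 * (n * (n * n))
      e₂ = solve-∀

-- Average interval length and AM-GM

-- With κ the integer part of n/g, Markov's inequality leaves at most 15 n²/g pairs having more than
-- κ misfit third points; these are marked by `β`. Going from triples to pairs costs one factor g,
-- hence `g * g` in the hypothesis. With R = 2 m, the constant is 76 = 8 + 8 + 60: the two parts of
-- `W`, and the marked pairs.
∑-size-bound : ∀ {n m g} (s : Fin n → Fin n → ℕ) → (∀ x y → s x y ≡ s y x) → (∀ x y → s x y ≤ 2 * m) →
  1 ≤ n → 1 ≤ g → g ≤ n →
  g * g * ∑³ (allFin n) (λ x y z → lt (suc (3 * m)) (s x y + (s x z + s y z))) ≤ 15 * (n * (n * n)) →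
  g * ∑² (allFin n) s ≤ g * (m * (n * n)) + 76 * (m * (n * n))
∑-size-bound {n} {m} {g} s s-sym s≤ 1≤n 1≤g g≤n few with floor n g 1≤g
... | κ , κ≤ , ≤κ = begin
  g * ∑² V s
    ≤⟨ *-monoʳ-≤ g (Mantel.bound s β s-sym m R κ s≤ (length V) V ≤-refl fine) ⟩
  g * (m * (length V * length V) + length V * W + 2 * R * Sβ)
    ≡⟨ cong (λ k → g * (m * (k * k) + k * W + 2 * R * Sβ)) (length-allFin n) ⟩
  g * (m * (n * n) + n * W + 2 * R * Sβ)
    ≡⟨ expand g m n κ Sβ ⟩
  g * (m * (n * n)) + (8 * (m * n) * g + 8 * (m * n) * (g * κ) + 4 * m * (g * Sβ))
    ≤⟨ +-monoʳ-≤ (g * (m * (n * n))) (+-mono-≤ (+-mono-≤ (*-monoʳ-≤ (8 * (m * n)) g≤n) (*-monoʳ-≤ (8 * (m * n)) κ≤))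
         (*-monoʳ-≤ (4 * m) Sβ-bound)) ⟩
  g * (m * (n * n)) + (8 * (m * n) * n + 8 * (m * n) * n + 4 * m * (15 * (n * n)))
    ≡⟨ collect g m n ⟩
  g * (m * (n * n)) + 76 * (m * (n * n)) ∎
  where
  open ≤-Reasoning
  V = allFin n
  R = 2 * m
  W = 4 * R + 4 * (R * κ)
  bad : Fin n → Fin n → Fin n → ℕ
  bad x y z = lt (suc (3 * m)) (s x y + (s x z + s y z))
  β : Fin n → Fin n → ℕ
  β x y = lt κ (∑ V (bad x y))
  Sβ = ∑² V β
  fine : Mantel.Fine s β s-sym m R κ s≤ V
  fine x y with κ <? ∑ V (bad x y)
  ... | yes p = inj₁ (≤-trans (s≤ x y) (≤-trans (≤-reflexive (sym (trans (cong (R *_) (lt≡1 p)) (*-identityʳ R))))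
    (m≤n+m _ m)))
  ... | no ¬p = inj₂ (≮⇒≥ ¬p)
  Sβ-bound : g * Sβ ≤ 15 * (n * n)
  Sβ-bound = *-cancelˡ-≤ n {{>-nonZero 1≤n}} (begin
    n * (g * Sβ)                   ≤⟨ *-monoˡ-≤ (g * Sβ) ≤κ ⟩
    g * suc κ * (g * Sβ)           ≡⟨ e₁ g (suc κ) Sβ ⟩
    g * g * (suc κ * Sβ)           ≡⟨ cong (g * g *_) (sym (∑²-* V (suc κ) β)) ⟩
    g * g * ∑² V (λ x y → suc κ * β x y) ≤⟨ *-monoʳ-≤ (g * g) (∑²-mono V λ x y → markov κ _) ⟩
    g * g * ∑³ V bad               ≤⟨ few ⟩
    15 * (n * (n * n))             ≡⟨ e₂ n ⟩
    n * (15 * (n * n))             ∎)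
    where
    e₁ : ∀ g k b → g * k * (g * b) ≡ g * g * (k * b)
    e₁ = solve-∀
    e₂ : ∀ n → 15 * (n * (n * n)) ≡ n * (15 * (n * n))
    e₂ = solve-∀
  expand : ∀ g m n κ b → g * (m * (n * n) + n * (4 * (2 * m) + 4 * (2 * m * κ)) + 2 * (2 * m) * b)
    ≡ g * (m * (n * n)) + (8 * (m * n) * g + 8 * (m * n) * (g * κ) + 4 * m * (g * b))
  expand = solve-∀
  collect : ∀ g m n → g * (m * (n * n)) + (8 * (m * n) * n + 8 * (m * n) * n + 4 * m * (15 * (n * n)))
    ≡ g * (m * (n * n)) + 76 * (m * (n * n))
  collect = solve-∀

-- Products over pairs and weighted AM-GM

∏² : {A : Set} → List A → (A → A → ℕ) → ℕ
∏² V f = ∏ V (λ x → ∏ V (f x))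

module _ {A : Set} (V : List A) where

  ∏²-mono : {f g : A → A → ℕ} → (∀ x y → f x y ≤ g x y) → ∏² V f ≤ ∏² V g
  ∏²-mono h = ∏-mono V (λ x → ∏-mono V (h x))

  ∏²-cong : {f g : A → A → ℕ} → (∀ x y → f x y ≡ g x y) → ∏² V f ≡ ∏² V g
  ∏²-cong h = ∏-cong V (λ x → ∏-cong V (h x))

  ∏²-* : (f g : A → A → ℕ) → ∏² V (λ x y → f x y * g x y) ≡ ∏² V f * ∏² V g
  ∏²-* f g = trans (∏-cong V (λ x → ∏-* V (f x) (g x))) (∏-* V _ _)

  ∏²-^ : (a : ℕ) (f : A → A → ℕ) → ∏² V (λ x y → a ^ f x y) ≡ a ^ ∑² V f
  ∏²-^ a f = trans (∏-cong V (λ x → ∏-^ V a (f x))) (∏-^ V a _)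

-- u ≤ c (1 + 1/c)^(u − c), the tangent inequality at u = c, cleared of denominators.
tangent : ∀ c u → u * (suc c ^ c * c ^ u) ≤ c * (suc c ^ u * c ^ c)
tangent c u with ≤-total c u
... | inj₁ c≤u = subst (λ v → v * (suc c ^ c * c ^ v) ≤ c * (suc c ^ v * c ^ c)) (m+[n∸m]≡n c≤u) (above (u ∸ c))
  where
  open ≤-Reasoning
  -- Bernoulli's inequality 1 + k/c ≤ (1 + 1/c)^k, cleared of denominators.
  core : ∀ k → (c + k) * c ^ k ≤ c * suc c ^ k
  core zero    = ≤-reflexive (cong (_* 1) (+-identityʳ c))
  core (suc k) = begin
    (c + suc k) * (c * c ^ k)          ≤⟨ m≤m+n _ (k * c ^ k) ⟩
    (c + suc k) * (c * c ^ k) + k * c ^ k ≡⟨ e c k (c ^ k) ⟩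
    suc c * ((c + k) * c ^ k)          ≤⟨ *-monoʳ-≤ (suc c) (core k) ⟩
    suc c * (c * suc c ^ k)            ≡⟨ e′ (suc c) c (suc c ^ k) ⟩
    c * (suc c * suc c ^ k)            ∎
    where
    e : ∀ c k p → (c + suc k) * (c * p) + k * p ≡ suc c * ((c + k) * p)
    e = solve-∀
    e′ : ∀ a b p → a * (b * p) ≡ b * (a * p)
    e′ = solve-∀
  above : ∀ k → (c + k) * (suc c ^ c * c ^ (c + k)) ≤ c * (suc c ^ (c + k) * c ^ c)
  above k = begin
    (c + k) * (suc c ^ c * c ^ (c + k))     ≡⟨ cong (λ t → (c + k) * (suc c ^ c * t)) (^-distribˡ-+-* c c k) ⟩
    (c + k) * (suc c ^ c * (c ^ c * c ^ k)) ≡⟨ e₁ (c + k) (suc c ^ c) (c ^ c) (c ^ k) ⟩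
    (suc c ^ c * c ^ c) * ((c + k) * c ^ k) ≤⟨ *-monoʳ-≤ (suc c ^ c * c ^ c) (core k) ⟩
    (suc c ^ c * c ^ c) * (c * suc c ^ k)   ≡⟨ e₂ (suc c ^ c) (c ^ c) c (suc c ^ k) ⟩
    c * (suc c ^ c * suc c ^ k * c ^ c)     ≡⟨ cong (λ t → c * (t * c ^ c)) (sym (^-distribˡ-+-* (suc c) c k)) ⟩
    c * (suc c ^ (c + k) * c ^ c)           ∎
    where
    e₁ : ∀ a t p q → a * (t * (p * q)) ≡ (t * p) * (a * q)
    e₁ = solve-∀
    e₂ : ∀ t p c q → (t * p) * (c * q) ≡ c * (t * q * p)
    e₂ = solve-∀
... | inj₂ u≤c = below (c ∸ u) (m+[n∸m]≡n u≤c)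
  where
  open ≤-Reasoning
  -- The case below c, with u = c - j: here (1 - j/c)(1 + 1/c)^j ≤ 1, since raising u by 1 gains at
  -- least a factor 1 + 1/c.
  core : ∀ j u → u + j ≡ c → u * suc c ^ j ≤ c * c ^ j
  core zero    u eq = ≤-reflexive (cong (_* 1) (trans (sym (+-identityʳ u)) eq))
  core (suc j) u eq = begin
    u * (suc c * suc c ^ j)            ≡⟨ sym (*-assoc u (suc c) _) ⟩
    u * suc c * suc c ^ j              ≤⟨ *-monoˡ-≤ (suc c ^ j) step ⟩
    c * suc u * suc c ^ j              ≡⟨ *-assoc c (suc u) _ ⟩
    c * (suc u * suc c ^ j)            ≤⟨ *-monoʳ-≤ c (core j (suc u) (trans (sym (+-suc u j)) eq)) ⟩
    c * (c * c ^ j)                    ∎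
    where
    step : u * suc c ≤ c * suc u
    step = begin
      u * suc c   ≡⟨ *-suc u c ⟩
      u + u * c   ≤⟨ +-monoˡ-≤ (u * c) (subst (u ≤_) eq (m≤m+n u (suc j))) ⟩
      c + u * c   ≡⟨ *-comm (suc u) c ⟩
      c * suc u   ∎
  below : ∀ j → u + j ≡ c → u * (suc c ^ c * c ^ u) ≤ c * (suc c ^ u * c ^ c)
  below j eq = begin
    u * (suc c ^ c * c ^ u)                 ≡⟨ cong (λ t → u * (t * c ^ u)) (split (suc c)) ⟩
    u * (suc c ^ u * suc c ^ j * c ^ u)     ≡⟨ e₁ u (suc c ^ u) (suc c ^ j) (c ^ u) ⟩
    (suc c ^ u * c ^ u) * (u * suc c ^ j)   ≤⟨ *-monoʳ-≤ (suc c ^ u * c ^ u) (core j u eq) ⟩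
    (suc c ^ u * c ^ u) * (c * c ^ j)       ≡⟨ e₂ (suc c ^ u) (c ^ u) c (c ^ j) ⟩
    c * (suc c ^ u * (c ^ u * c ^ j))       ≡⟨ cong (λ t → c * (suc c ^ u * t)) (sym (split c)) ⟩
    c * (suc c ^ u * c ^ c)                 ∎
    where
    split : ∀ a → a ^ c ≡ a ^ u * a ^ j
    split a = trans (cong (a ^_) (sym eq)) (^-distribˡ-+-* a u j)
    e₁ : ∀ u t p q → u * (t * p * q) ≡ (t * q) * (u * p)
    e₁ = solve-∀
    e₂ : ∀ t p c q → (t * p) * (c * q) ≡ c * (t * (p * q))
    e₂ = solve-∀

^-distrib-* : ∀ a b k → (a * b) ^ k ≡ a ^ k * b ^ k
^-distrib-* a b zero    = refl
^-distrib-* a b (suc k) = trans (cong (a * b *_) (^-distrib-* a b k)) (e a b (a ^ k) (b ^ k))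
  where
  e : ∀ a b p q → (a * b) * (p * q) ≡ (a * p) * (b * q)
  e = solve-∀

1≤^ : ∀ {a} k → 1 ≤ a → 1 ≤ a ^ k
1≤^ {a} k p = m^n>0 a {{>-nonZero p}} k

amgm : {A : Set} (V : List A) (h u : A → A → ℕ) (c G : ℕ) → 1 ≤ c →
  ∑² V (λ x y → h x y * u x y) ≤ c * ∑² V h + G →
  ∏² V (λ x y → u x y ^ h x y) * c ^ G ≤ c ^ ∑² V h * suc c ^ G
amgm V h u c G 1≤c U≤ = *-cancelˡ-≤ (t ^ (c * N) * c ^ (c * N)) {{>-nonZero (*-mono-≤ (1≤^ (c * N) (s≤s (z≤n {c}))) (1≤^ (c * N) 1≤c))}} (begin
  t ^ (c * N) * c ^ (c * N) * (P * c ^ G)   ≡⟨ e₁ (t ^ (c * N)) (c ^ (c * N)) P (c ^ G) ⟩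
  P * (t ^ (c * N) * (c ^ (c * N) * c ^ G)) ≡⟨ cong (λ z → P * (t ^ (c * N) * z)) (sym (^-distribˡ-+-* c (c * N) G)) ⟩
  P * (t ^ (c * N) * c ^ (c * N + G))       ≡⟨ cong (λ z → P * (t ^ (c * N) * c ^ z)) (sym eq) ⟩
  P * (t ^ (c * N) * c ^ (U + k))           ≡⟨ cong (λ z → P * (t ^ (c * N) * z)) (^-distribˡ-+-* c U k) ⟩
  P * (t ^ (c * N) * (c ^ U * c ^ k))       ≡⟨ e₂ P (t ^ (c * N)) (c ^ U) (c ^ k) ⟩
  P * (t ^ (c * N) * c ^ U) * c ^ k         ≤⟨ *-mono-≤ product (^-monoˡ-≤ k (n≤1+n c)) ⟩
  c ^ N * (t ^ U * c ^ (c * N)) * t ^ k     ≡⟨ e₃ (c ^ N) (t ^ U) (c ^ (c * N)) (t ^ k) ⟩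
  c ^ N * (c ^ (c * N) * (t ^ U * t ^ k))   ≡⟨ cong (λ z → c ^ N * (c ^ (c * N) * z))
      (trans (sym (^-distribˡ-+-* t U k)) (trans (cong (t ^_) eq) (^-distribˡ-+-* t (c * N) G))) ⟩
  c ^ N * (c ^ (c * N) * (t ^ (c * N) * t ^ G)) ≡⟨ e₄ (c ^ N) (c ^ (c * N)) (t ^ (c * N)) (t ^ G) ⟩
  t ^ (c * N) * c ^ (c * N) * (c ^ N * t ^ G) ∎)
  where
  open ≤-Reasoning
  t = suc c
  N = ∑² V h
  U = ∑² V (λ x y → h x y * u x y)
  P = ∏² V (λ x y → u x y ^ h x y)
  k = c * N + G ∸ U
  eq : U + k ≡ c * N + G
  eq = m+[n∸m]≡n U≤
  product : P * (t ^ (c * N) * c ^ U) ≤ c ^ N * (t ^ U * c ^ (c * N))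
  product = begin
    P * (t ^ (c * N) * c ^ U)
      ≡⟨ cong (P *_) (cong₂ _*_ (scaled t) (powers c)) ⟩
    P * (∏² V (λ x y → t ^ (c * h x y)) * ∏² V (λ x y → c ^ (h x y * u x y)))
      ≡⟨ sym (trans (∏²-* V _ _) (cong (P *_) (∏²-* V _ _))) ⟩
    ∏² V (λ x y → u x y ^ h x y * (t ^ (c * h x y) * c ^ (h x y * u x y)))
      ≤⟨ ∏²-mono V pointwise ⟩
    ∏² V (λ x y → c ^ h x y * (t ^ (h x y * u x y) * c ^ (c * h x y)))
      ≡⟨ trans (∏²-* V _ _) (cong₂ _*_ (∏²-^ V c h) (∏²-* V _ _)) ⟩
    c ^ N * (∏² V (λ x y → t ^ (h x y * u x y)) * ∏² V (λ x y → c ^ (c * h x y)))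
      ≡⟨ cong (c ^ N *_) (sym (cong₂ _*_ (powers t) (scaled c))) ⟩
    c ^ N * (t ^ U * c ^ (c * N)) ∎
    where
    powers : ∀ a → a ^ U ≡ ∏² V (λ x y → a ^ (h x y * u x y))
    powers a = sym (∏²-^ V a _)
    scaled : ∀ a → a ^ (c * N) ≡ ∏² V (λ x y → a ^ (c * h x y))
    scaled a = sym (trans (∏²-^ V a _) (cong (a ^_) (∑²-* V c h)))
    pointwise : ∀ x y → u x y ^ h x y * (t ^ (c * h x y) * c ^ (h x y * u x y))
      ≤ c ^ h x y * (t ^ (h x y * u x y) * c ^ (c * h x y))
    pointwise x y = begin
      v ^ w * (t ^ (c * w) * c ^ (w * v))
        ≡⟨ cong (v ^ w *_) (cong₂ _*_ (sym (^-*-assoc t c w)) (trans (cong (c ^_) (*-comm w v)) (sym (^-*-assoc c v w)))) ⟩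
      v ^ w * ((t ^ c) ^ w * (c ^ v) ^ w)
        ≡⟨ cong (v ^ w *_) (sym (^-distrib-* (t ^ c) (c ^ v) w)) ⟩
      v ^ w * (t ^ c * c ^ v) ^ w
        ≡⟨ sym (^-distrib-* v _ w) ⟩
      (v * (t ^ c * c ^ v)) ^ w
        ≤⟨ ^-monoˡ-≤ w (tangent c v) ⟩
      (c * (t ^ v * c ^ c)) ^ w
        ≡⟨ ^-distrib-* c _ w ⟩
      c ^ w * (t ^ v * c ^ c) ^ w
        ≡⟨ cong (c ^ w *_) (^-distrib-* (t ^ v) (c ^ c) w) ⟩
      c ^ w * ((t ^ v) ^ w * (c ^ c) ^ w)
        ≡⟨ cong (c ^ w *_) (cong₂ _*_ (trans (^-*-assoc t v w) (cong (t ^_) (*-comm v w))) (^-*-assoc c c w)) ⟩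
      c ^ w * (t ^ (w * v) * c ^ (c * w)) ∎
      where
      v = u x y
      w = h x y
  e₁ : ∀ a b p g → a * b * (p * g) ≡ p * (a * (b * g))
  e₁ = solve-∀
  e₂ : ∀ p a b k → p * (a * (b * k)) ≡ p * (a * b) * k
  e₂ = solve-∀
  e₃ : ∀ n a b k → n * (a * b) * k ≡ n * (b * (a * k))
  e₃ = solve-∀
  e₄ : ∀ n b a g → n * (b * (a * g)) ≡ a * b * (n * g)
  e₄ = solve-∀

-- By induction (1 + 1/c)^i ≤ 1 + 2i/c as long as i ≤ c/2; at i = j = c/2 the right side is 2.
half-power : ∀ j → 1 ≤ j → suc (2 * j) ^ j ≤ 2 * (2 * j) ^ j
half-power j 1≤j = *-cancelʳ-≤ _ _ c {{>-nonZero (*-mono-≤ (s≤s (z≤n {1})) 1≤j)}} (begin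
  suc c ^ j * c          ≤⟨ power j ≤-refl ⟩
  c ^ j * (c + c)        ≡⟨ e (c ^ j) c ⟩
  2 * c ^ j * c          ∎)
  where
  open ≤-Reasoning
  c = 2 * j
  e : ∀ p c → p * (c + c) ≡ 2 * p * c
  e = solve-∀
  power : ∀ i → i ≤ j → suc c ^ i * c ≤ c ^ i * (c + 2 * i)
  power zero    _   = ≤-reflexive (cong (1 *_) (sym (+-identityʳ c)))
  power (suc i) i<j = begin
    suc c * suc c ^ i * c            ≡⟨ *-assoc (suc c) (suc c ^ i) c ⟩
    suc c * (suc c ^ i * c)          ≤⟨ *-monoʳ-≤ (suc c) (power i (<⇒≤ i<j)) ⟩
    suc c * (c ^ i * (c + 2 * i))    ≡⟨ e₁ c (c ^ i) i ⟩
    c ^ i * (c * (c + 2 * i) + c + 2 * i) ≤⟨ *-monoʳ-≤ (c ^ i) (+-monoʳ-≤ (c * (c + 2 * i) + c) (*-monoʳ-≤ 2 (<⇒≤ i<j))) ⟩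
    c ^ i * (c * (c + 2 * i) + c + c) ≡⟨ e₂ c (c ^ i) i ⟩
    c * c ^ i * (c + 2 * suc i)      ∎
    where
    e₁ : ∀ c p i → suc c * (p * (c + 2 * i)) ≡ p * (c * (c + 2 * i) + c + 2 * i)
    e₁ = solve-∀
    e₂ : ∀ c p i → p * (c * (c + 2 * i) + c + c) ≡ c * p * (c + 2 * suc i)
    e₂ = solve-∀

-- An even mean c = 2j lets the excess be measured in units of c/2, and each unit costs at most a
-- factor 2.
amgm-even : {A : Set} (V : List A) (h u : A → A → ℕ) (j q : ℕ) → 1 ≤ j →
  ∑² V (λ x y → h x y * u x y) ≤ 2 * j * ∑² V h + j * q →
  ∏² V (λ x y → u x y ^ h x y) ≤ (2 * j) ^ ∑² V h * 2 ^ q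
amgm-even V h u j q 1≤j U≤ = *-cancelʳ-≤ _ _ (c ^ (j * q)) {{>-nonZero (1≤^ (j * q) 1≤c)}} (begin
  ∏² V (λ x y → u x y ^ h x y) * c ^ (j * q)  ≤⟨ amgm V h u c (j * q) 1≤c U≤ ⟩
  c ^ N * suc c ^ (j * q)                     ≡⟨ cong (c ^ N *_) (sym (^-*-assoc (suc c) j q)) ⟩
  c ^ N * (suc c ^ j) ^ q                     ≤⟨ *-monoʳ-≤ (c ^ N) (^-monoˡ-≤ q (half-power j 1≤j)) ⟩
  c ^ N * (2 * c ^ j) ^ q                     ≡⟨ cong (c ^ N *_) (^-distrib-* 2 (c ^ j) q) ⟩
  c ^ N * (2 ^ q * (c ^ j) ^ q)               ≡⟨ cong (λ z → c ^ N * (2 ^ q * z)) (^-*-assoc c j q) ⟩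
  c ^ N * (2 ^ q * c ^ (j * q))               ≡⟨ sym (*-assoc (c ^ N) (2 ^ q) _) ⟩
  c ^ N * 2 ^ q * c ^ (j * q)                 ∎)
  where
  open ≤-Reasoning
  c = 2 * j
  N = ∑² V h
  1≤c : 1 ≤ c
  1≤c = *-mono-≤ (s≤s (z≤n {1})) 1≤j

-- Tables, and the lower bound

<ᵇ-true : ∀ {a b} → a < b → (a <ᵇ b) ≡ true
<ᵇ-true {a} {b} p with a <ᵇ b in eq
... | true  = refl
... | false = ⊥-elim (subst T eq (<⇒<ᵇ p))

<ᵇ-false : ∀ {a b} → b ≤ a → (a <ᵇ b) ≡ false
<ᵇ-false {a} {b} p with a <ᵇ b in eq
... | false = refl
... | true  = ⊥-elim (<⇒≱ (<ᵇ⇒< a b (subst T (sym eq) _)) p)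

-- Used as a weight and as an exponent: sums and products over all (x, y) then count each unordered
-- pair once.
ordered : ∀ {n} → Fin n → Fin n → ℕ
ordered x y = if toℕ x <ᵇ toℕ y then 1 else 0

∑²-ordered : ∀ n → ∑² (allFin n) ordered ≡ n C 2
∑²-ordered zero    = refl
∑²-ordered (suc n) = begin
  ∑² (allFin (suc n)) ordered
    ≡⟨ ∑-allFin-suc n (λ x → ∑ (allFin (suc n)) (ordered x)) ⟩
  ∑ (allFin (suc n)) (ordered zero) + ∑ (allFin n) (λ x → ∑ (allFin (suc n)) (ordered (suc x)))
    ≡⟨ cong₂ _+_ (∑-allFin-suc n (ordered zero)) (∑-cong (allFin n) λ x → ∑-allFin-suc n (ordered (suc x))) ⟩
  ∑ (allFin n) (λ _ → 1) + ∑² (allFin n) ordered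
    ≡⟨ cong₂ _+_ (trans (∑-const (allFin n) 1) (trans (*-identityʳ _) (trans (length-allFin n) (sym (nC1≡n n)))))
         (∑²-ordered n) ⟩
  n C 1 + n C 2
    ≡⟨ nCk+nC[k+1]≡[n+1]C[k+1] n 1 ⟩
  suc n C 2 ∎
  where open ≡-Reasoning

∑²-ordered-sym : ∀ {n} (u : Fin n → Fin n → ℕ) → (∀ x y → u x y ≡ u y x) →
  2 * ∑² (allFin n) (λ x y → ordered x y * u x y) ≤ ∑² (allFin n) u
∑²-ordered-sym {n} u u-sym = begin
  2 * S                                                    ≡⟨ cong (S +_) (+-identityʳ S) ⟩
  S + S                                                    ≡⟨ cong (S +_) (∑²-swap V _) ⟩
  S + ∑² V (λ x y → ordered y x * u y x)                   ≡⟨ sym (∑²-+ V _ _) ⟩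
  ∑² V (λ x y → ordered x y * u x y + ordered y x * u y x) ≤⟨ ∑²-mono V pointwise ⟩
  ∑² V u                                                   ∎
  where
  open ≤-Reasoning
  V = allFin n
  S = ∑² V (λ x y → ordered x y * u x y)
  pointwise : ∀ x y → ordered x y * u x y + ordered y x * u y x ≤ u x y
  pointwise x y with ≤-total (toℕ x) (toℕ y)
  ... | inj₁ p rewrite <ᵇ-false p | +-identityʳ (ordered x y * u x y) with toℕ x <ᵇ toℕ y
  ...   | true  = ≤-reflexive (*-identityˡ _)
  ...   | false = z≤n
  pointwise x y | inj₂ p rewrite <ᵇ-false p | u-sym x y with toℕ y <ᵇ toℕ x
  ...   | true  = ≤-reflexive (*-identityˡ _)
  ...   | false = z≤n

2*∑²-ordered : ∀ n → 2 * ∑² (allFin n) ordered + n ≡ n * n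
2*∑²-ordered zero    = refl
2*∑²-ordered (suc n) = begin
  2 * ∑² (allFin (suc n)) ordered + suc n
    ≡⟨ cong (λ t → 2 * t + suc n) (trans (∑²-ordered (suc n)) (trans (sym (nCk+nC[k+1]≡[n+1]C[k+1] n 1))
         (cong₂ _+_ (nC1≡n n) (sym (∑²-ordered n))))) ⟩
  2 * (n + N) + suc n        ≡⟨ e₁ n N ⟩
  (2 * N + n) + (2 * n + 1)  ≡⟨ cong (_+ (2 * n + 1)) (2*∑²-ordered n) ⟩
  n * n + (2 * n + 1)        ≡⟨ e₂ n ⟩
  suc n * suc n              ∎
  where
  open ≡-Reasoning
  N = ∑² (allFin n) ordered
  e₁ : ∀ n N → 2 * (n + N) + suc n ≡ (2 * N + n) + (2 * n + 1)
  e₁ = solve-∀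
  e₂ : ∀ n → n * n + (2 * n + 1) ≡ suc n * suc n
  e₂ = solve-∀

-- [a ≤ v ≤ b] as a number
inside : ℕ → ℕ → ℕ → ℕ
inside zero    b       zero    = 1
inside (suc a) b       zero    = 0
inside a       zero    (suc v) = 0
inside zero    (suc b) (suc v) = inside zero b v
inside (suc a) (suc b) (suc v) = inside a b v

inside≤1 : ∀ a b v → inside a b v ≤ 1
inside≤1 zero    b       zero    = ≤-refl
inside≤1 (suc a) b       zero    = z≤n
inside≤1 zero    zero    (suc v) = z≤n
inside≤1 (suc a) zero    (suc v) = z≤n
inside≤1 zero    (suc b) (suc v) = inside≤1 zero b v
inside≤1 (suc a) (suc b) (suc v) = inside≤1 a b v

inside≡1 : ∀ {a b v} → a ≤ v → v ≤ b → inside a b v ≡ 1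
inside≡1 {v = zero}  z≤n     q       = refl
inside≡1 {v = suc v} z≤n     (s≤s q) = inside≡1 {v = v} z≤n q
inside≡1             (s≤s p) (s≤s q) = inside≡1 p q

inside≢0 : ∀ a b v → inside a b v ≢ 0 → a ≤ v
inside≢0 zero    b       v       h = z≤n
inside≢0 (suc a) b       zero    h = ⊥-elim (h refl)
inside≢0 (suc a) zero    (suc v) h = ⊥-elim (h refl)
inside≢0 (suc a) (suc b) (suc v) h = s≤s (inside≢0 a b v h)

∑-zero : {A : Set} (xs : List A) → ∑ xs (λ _ → 0) ≡ 0
∑-zero xs = trans (∑-const xs 0) (*-zeroʳ (length xs))

∑-inside≤ : ∀ r a b → ∑ (allFin r) (λ v → inside a b (toℕ v)) ≤ suc b ∸ a
∑-inside≤ zero    a b = z≤n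
∑-inside≤ (suc r) a b = ≤-trans (≤-reflexive (∑-allFin-suc r (λ v → inside a b (toℕ v)))) (tail a b)
  where
  tail : ∀ a b → inside a b 0 + ∑ (allFin r) (λ v → inside a b (suc (toℕ v))) ≤ suc b ∸ a
  tail zero    zero    = ≤-reflexive (cong suc (∑-zero (allFin r)))
  tail zero    (suc b) = s≤s (∑-inside≤ r zero b)
  tail (suc a) zero    = ≤-trans (≤-reflexive (∑-zero (allFin r))) z≤n
  tail (suc a) (suc b) = ∑-inside≤ r a b

∑-inside≥ : ∀ r a b → r ≤ b → r ∸ a ≤ ∑ (allFin r) (λ v → inside a b (toℕ v))
∑-inside≥ zero    a b p = ≤-trans (≤-reflexive (0∸n≡0 a)) z≤n
∑-inside≥ (suc r) a (suc b) (s≤s p) = ≤-trans (head a) (≤-reflexive (sym (∑-allFin-suc r (λ v → inside a (suc b) (toℕ v)))))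
  where
  head : ∀ a → suc r ∸ a ≤ inside a (suc b) 0 + ∑ (allFin r) (λ v → inside a (suc b) (suc (toℕ v)))
  head zero    = s≤s (∑-inside≥ r zero b p)
  head (suc a) = ∑-inside≥ r a b p

∑-1∸ : ∀ r → ∑ (allFin (suc r)) (λ v → 1 ∸ toℕ v) ≡ 1
∑-1∸ r = trans (∑-allFin-suc r (λ v → 1 ∸ toℕ v)) (cong suc (trans (∑-cong (allFin r) (λ v → 0∸n≡0 (toℕ v))) (∑-zero (allFin r))))

tables : ∀ n r → List (Table n r)
tables n r = allFuns n (allFuns n (allFin r))

∑-tables : ∀ n r (w : Fin n → Fin n → Fin r → ℕ) →
  ∑ (tables n r) (λ d → ∏² (allFin n) (λ x y → w x y (d x y))) ≡ ∏² (allFin n) (λ x y → ∑ (allFin r) (w x y))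
∑-tables n r w = trans
  (∑-allFuns n (allFuns n (allFin r)) (λ x ρ → ∏ (allFin n) (λ y → w x y (ρ y))))
  (∏-cong (allFin n) (λ x → ∑-allFuns n (allFin r) (w x)))

dist-< : ∀ {n r} (d : Table n r) {x y} → toℕ x < toℕ y → dist d x y ≡ suc (toℕ (d x y))
dist-< d p rewrite <ᵇ-true p = refl

dist-> : ∀ {n r} (d : Table n r) {x y} → toℕ y ≤ toℕ x → dist d x y ≡ suc (toℕ (d y x))
dist-> d p rewrite <ᵇ-false p = refl

dist-sym : ∀ {n r} (d : Table n r) x y → dist d x y ≡ dist d y x
dist-sym d x y with <-cmp (toℕ x) (toℕ y)
... | tri< p _ _ = trans (dist-< d p) (sym (dist-> d (<⇒≤ p)))
... | tri≈ _ p _ rewrite toℕ-injective p = refl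
... | tri> _ _ p = trans (dist-> d (<⇒≤ p)) (sym (dist-< d p))

dist≤r : ∀ {n r} (d : Table n r) x y → dist d x y ≤ r
dist≤r d x y = toℕ<n (if toℕ x <ᵇ toℕ y then d x y else d y x)

-- Coincident points are included because normalisation makes the diagonal value 1, which is
-- harmless on either side. The landmark arguments can then range over all points without case
-- distinctions.
dist-triangle : ∀ {n r} (d : Table n r) → IsMetric d → ∀ x y z → dist d x y ≤ dist d z x + dist d z y
dist-triangle d (normal , triangle) x y z with x F.≟ y | z F.≟ x | z F.≟ y
... | yes refl | _ | _ = ≤-trans (≤-reflexive diagonal) (s≤s z≤n)
  where
  diagonal : dist d x x ≡ 1
  diagonal = trans (dist-> d ≤-refl) (cong suc (normal x x ≤-refl))
... | no _ | yes refl | _ = m≤n+m _ (dist d z z)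
... | no _ | no _ | yes refl = ≤-trans (≤-reflexive (dist-sym d x z)) (m≤m+n _ _)
... | no x≢y | no z≢x | no z≢y = ≤-trans (triangle x y z x≢y (λ e → z≢x (sym e)) z≢y)
  (≤-reflexive (cong (_+ dist d z y) (dist-sym d x z)))

-- The product of the 0/1 weights `w` vanishes at every table that is not a metric, so its sum over
-- all tables, which factors, is a lower bound. Any two allowed distances add up to at least
-- `2 * suc (r ∸ m)`, hence to at least `r`.
numMetrics-≥ : ∀ n r m → 1 ≤ r → m ≤ r → r ≤ 2 * suc (r ∸ m) → m ^ (n C 2) ≤ numMetrics n r
numMetrics-≥ n r@(suc r-1) m _ m≤r r≤ = begin
  m ^ (n C 2)                                      ≡⟨ cong (m ^_) (sym (∑²-ordered n)) ⟩
  m ^ ∑² V ordered                                 ≡⟨ sym (∏²-^ V m ordered) ⟩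
  ∏² V (λ x y → m ^ ordered x y)                   ≤⟨ ∏²-mono V pointwise ⟩
  ∏² V (λ x y → ∑ (allFin r) (w x y))              ≡⟨ sym (∑-tables n r w) ⟩
  ∑ (tables n r) (λ d → ∏² V (λ x y → w x y (d x y))) ≤⟨ ∑-filter-≥ isMetric? (tables n r) _ product≤1 product≡0 ⟩
  numMetrics n r ∎
  where
  open ≤-Reasoning
  V = allFin n
  w : Fin n → Fin n → Fin r → ℕ
  -- An entry v with r - m ≤ v < r encodes a distance in {r - m + 1, ..., r}: m choices. On the
  -- other entries `1 ∸ toℕ v` is the indicator of 0, which enforces normalisation.
  w x y v = if toℕ x <ᵇ toℕ y then inside (r ∸ m) r (toℕ v) else (1 ∸ toℕ v)
  pointwise : ∀ x y → m ^ ordered x y ≤ ∑ (allFin r) (w x y)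
  pointwise x y with toℕ x <ᵇ toℕ y
  ... | true  = ≤-trans (≤-reflexive (trans (*-identityʳ m) (sym (m∸[m∸n]≡n m≤r)))) (∑-inside≥ r (r ∸ m) r ≤-refl)
  ... | false = ≤-reflexive (sym (∑-1∸ r-1))
  w≤1 : ∀ x y v → w x y v ≤ 1
  w≤1 x y v with toℕ x <ᵇ toℕ y
  ... | true  = inside≤1 (r ∸ m) r (toℕ v)
  ... | false = m∸n≤m 1 (toℕ v)
  product≤1 : ∀ d → ∏² V (λ x y → w x y (d x y)) ≤ 1
  product≤1 d = ≤-trans (∏²-mono V (λ x y → w≤1 x y (d x y)))
    (≤-reflexive (∏≡1 V (λ x → ∏≡1 V (λ y → refl))))
  metric : ∀ d → (∀ x y → w x y (d x y) ≢ 0) → IsMetric d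
  metric d nz = normal , λ x y z x≢y x≢z z≢y → ≤-trans (dist≤r d x y) (≤-trans r≤
      (≤-trans (≤-reflexive (cong (suc (r ∸ m) +_) (+-identityʳ _))) (+-mono-≤ (far x z x≢z) (far z y z≢y))))
    where
    normal : Normalised d
    normal x y p with nz x y
    ... | q rewrite <ᵇ-false p with toℕ (d x y)
    ...   | zero  = refl
    ...   | suc k = ⊥-elim (q (0∸n≡0 k))
    near : ∀ x y → toℕ x < toℕ y → r ∸ m ≤ toℕ (d x y)
    near x y p with nz x y
    ... | q rewrite <ᵇ-true p = inside≢0 (r ∸ m) r _ q
    far : ∀ x y → x ≢ y → suc (r ∸ m) ≤ dist d x y
    far x y x≢y with ≤-total (toℕ x) (toℕ y)
    ... | inj₁ p = ≤-trans (s≤s (near x y x<y)) (≤-reflexive (sym (dist-< d x<y)))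
      where x<y = ≤∧≢⇒< p (λ e → x≢y (toℕ-injective e))
    ... | inj₂ p = ≤-trans (s≤s (near y x y<x)) (≤-reflexive (sym (dist-> d p)))
      where y<x = ≤∧≢⇒< p (λ e → x≢y (toℕ-injective (sym e)))
  product≡0 : ∀ d → ¬ IsMetric d → ∏² V (λ x y → w x y (d x y)) ≡ 0
  product≡0 d ¬metric with all? (λ x → all? (λ y → ¬? (w x y (d x y) ≟ 0)))
  ... | yes nz = ⊥-elim (¬metric (metric d nz))
  ... | no ¬nz with ¬∀⟶∃¬ n _ (λ x → all? (λ y → ¬? (w x y (d x y) ≟ 0))) ¬nz
  ...   | x , ¬nzx with ¬∀⟶∃¬ n _ (λ y → ¬? (w x y (d x y) ≟ 0)) ¬nzx
  ...     | y , ¬¬z = ∏≡0 _ (∈-allFin x) (∏≡0 _ (∈-allFin y) (decidable-stable (_ ≟ 0) ¬¬z))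

-- Enumeration of certificates

length-cartesianProductWith : {A B C : Set} (f : A → B → C) (xs : List A) (ys : List B) →
  length (cartesianProductWith f xs ys) ≡ length xs * length ys
length-cartesianProductWith f []       ys = refl
length-cartesianProductWith f (x ∷ xs) ys =
  trans (length-++ (map (f x) ys)) (cong₂ _+_ (length-map (f x) ys) (length-cartesianProductWith f xs ys))

-- Landmark rows are vectors and not functions so that each row is propositionally equal to a member
-- of this list.
vectors : {A : Set} → List A → (n : ℕ) → List (Vec A n)
vectors xs zero    = [] ∷ []
vectors xs (suc n) = cartesianProductWith _∷_ xs (vectors xs n)

length-vectors : {A : Set} (xs : List A) (n : ℕ) → length (vectors xs n) ≡ length xs ^ n
length-vectors xs zero    = refl
length-vectors xs (suc n) = trans (length-cartesianProductWith _∷_ xs _) (cong (length xs *_) (length-vectors xs n))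

∈-vectors : {A : Set} (xs : List A) → (∀ a → a ∈ xs) → ∀ {n} (v : Vec A n) → v ∈ vectors xs n
∈-vectors xs all []      = here refl
∈-vectors xs all (a ∷ v) = ∈-cartesianProductWith⁺ _∷_ (all a) (∈-vectors xs all v)

lists≤ : {A : Set} → List A → ℕ → List (List A)
lists≤ xs zero    = [] ∷ []
lists≤ xs (suc k) = [] ∷ cartesianProductWith _∷_ xs (lists≤ xs k)

length-lists≤ : {A : Set} (xs : List A) (k : ℕ) → length (lists≤ xs k) ≤ suc (length xs) ^ k
length-lists≤ xs zero    = ≤-refl
length-lists≤ xs (suc k) = +-mono-≤ (1≤^ k (s≤s (z≤n {length xs})))
  (≤-trans (≤-reflexive (length-cartesianProductWith _∷_ xs _)) (*-monoʳ-≤ (length xs) (length-lists≤ xs k)))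

∈-lists≤ : {A : Set} (xs : List A) → (∀ a → a ∈ xs) → ∀ k as → length as ≤ k → as ∈ lists≤ xs k
∈-lists≤ xs all zero    []       _       = here refl
∈-lists≤ xs all (suc k) []       _       = here refl
∈-lists≤ xs all (suc k) (a ∷ as) (s≤s p) = there (∈-cartesianProductWith⁺ _∷_ (all a) (∈-lists≤ xs all k as p))

landmarks : ∀ n r → List (Landmark n r)
landmarks n r = cartesianProduct (allFin n) (vectors (allFin r) n)

∈-landmarks : ∀ {n r} (l : Landmark n r) → l ∈ landmarks n r
∈-landmarks (x , v) = ∈-cartesianProductWith⁺ _,_ (∈-allFin x) (∈-vectors _ ∈-allFin v)

length-landmarks : ∀ n r → length (landmarks n r) ≡ n * r ^ n
length-landmarks n r = trans (length-cartesianProductWith _,_ (allFin n) _)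
  (cong₂ _*_ (length-allFin n) (trans (length-vectors (allFin r) n) (cong (_^ n) (length-allFin r))))

certificates : ∀ n r → ℕ → List (Certificate n r)
certificates n r k = cartesianProduct ls (cartesianProduct ls ls)
  where ls = lists≤ (landmarks n r) k

length-certificates : ∀ n r k → length (certificates n r k) ≤ suc (n * r ^ n) ^ (3 * k)
length-certificates n r k = begin
  length (certificates n r k)
    ≡⟨ trans (length-cartesianProductWith _,_ ls _) (cong (length ls *_) (length-cartesianProductWith _,_ ls ls)) ⟩
  length ls * (length ls * length ls)
    ≤⟨ *-mono-≤ b (*-mono-≤ b b) ⟩
  a ^ k * (a ^ k * a ^ k)
    ≡⟨ trans (cong (a ^ k *_) (sym (^-distribˡ-+-* a k k))) (sym (^-distribˡ-+-* a k (k + k))) ⟩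
  a ^ (k + (k + k))
    ≡⟨ cong (λ t → a ^ (k + (k + t))) (sym (+-identityʳ k)) ⟩
  a ^ (3 * k) ∎
  where
  open ≤-Reasoning
  ls = lists≤ (landmarks n r) k
  a = suc (n * r ^ n)
  b : length ls ≤ a ^ k
  b = ≤-trans (length-lists≤ (landmarks n r) k) (≤-reflexive (cong (λ t → suc t ^ k) (length-landmarks n r)))

∈-certificates : ∀ {n r} k (c : Certificate n r) → length (proj₁ c) ≤ k → length (proj₁ (proj₂ c)) ≤ k →
  length (proj₂ (proj₂ c)) ≤ k → c ∈ certificates n r k
∈-certificates k (Z , T , T′) p q s = ∈-cartesianProductWith⁺ _,_ (mem Z p)
  (∈-cartesianProductWith⁺ _,_ (mem T q) (mem T′ s))
  where
  mem : ∀ ls → length ls ≤ k → ls ∈ lists≤ (landmarks _ _) k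
  mem = ∈-lists≤ (landmarks _ _) ∈-landmarks k

-- Counting metrics by certificates

numMetrics-1≤1 : ∀ n → numMetrics n 1 ≤ 1
numMetrics-1≤1 n = begin
  numMetrics n 1
    ≡⟨ sym (*-identityʳ _) ⟩
  numMetrics n 1 * 1
    ≤⟨ ∑-filter-≤ isMetric? (tables n 1) (λ d → ∏² V (λ _ _ → 1)) 1
         (λ d _ → ≤-reflexive (sym (∏≡1 V (λ _ → ∏≡1 V (λ _ → refl))))) ⟩
  ∑ (tables n 1) (λ d → ∏² V (λ _ _ → 1))
    ≡⟨ ∑-tables n 1 (λ _ _ _ → 1) ⟩
  ∏² V (λ _ _ → 1)
    ≡⟨ ∏≡1 V (λ _ → ∏≡1 V (λ _ → refl)) ⟩
  1 ∎
  where
  open ≤-Reasoning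
  V = allFin n

double-count : {A C : Set} {P : A → Set} (P? : ∀ x → Dec (P x)) (xs : List A) (cs : List C) {a b : ℕ}
  (f : C → A → ℕ) → (∀ x → P x → ∃[ c ] c ∈ cs × a ≤ f c x) → (∀ c → ∑ xs (f c) ≤ b) →
  length (filter P? xs) * a ≤ length cs * b
double-count {P = P} P? xs cs {a} {b} f cover weigh = begin
  length (filter P? xs) * a     ≤⟨ ∑-filter-≤ P? xs (λ x → ∑ cs (λ c → f c x)) a covered ⟩
  ∑ xs (λ x → ∑ cs (λ c → f c x)) ≡⟨ ∑-swap xs cs (λ x c → f c x) ⟩
  ∑ cs (λ c → ∑ xs (f c))       ≤⟨ ∑-bound cs weigh ⟩
  length cs * b                 ∎
  where
  open ≤-Reasoning
  covered : ∀ x → P x → a ≤ ∑ cs (λ c → f c x)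
  covered x px with cover x px
  ... | c , c∈ , p = ≤-trans p (∑-∈ (λ c → f c x) c∈)

rowVectors : ∀ {n r} → Table n r → Fin n → Vec (Fin r) n
rowVectors d x = Vec.tabulate (λ y → if toℕ x <ᵇ toℕ y then d x y else d y x)

row-dist : ∀ {n r} (d : Table n r) x y → row (x , rowVectors d x) y ≡ dist d x y
row-dist d x y = cong (λ v → suc (toℕ v)) (lookup∘tabulate (λ y → if toℕ x <ᵇ toℕ y then d x y else d y x) y)

-- A table gains a factor Q for every pair whose distance lies in the range prescribed by the
-- certificate, so the few exceptional pairs need not be enumerated.
module Weight {n r : ℕ} (Q : ℕ) (1≤Q : 1 ≤ Q) where

  V = allFin n

  -- The `+ 1` keeps the weight of a metric positive at exceptional pairs; `1 ∸ toℕ v` selects the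
  -- normalised entry.
  weight : Certificate n r → Fin n → Fin n → Fin r → ℕ
  weight c x y v = if toℕ x <ᵇ toℕ y then Q * inside (lo c x y) (hi c x y) (suc (toℕ v)) + 1 else (1 ∸ toℕ v)

  total : Certificate n r → Table n r → ℕ
  total c d = ∏² V (λ x y → weight c x y (d x y))

  ∑-weight : ∀ c x y → ∑ (allFin r) (weight c x y) ≤ (Q * size c x y + r) ^ ordered x y
  ∑-weight c x y with toℕ x <ᵇ toℕ y
  ... | false = ∑-1∸≤ r
    where
    ∑-1∸≤ : ∀ r → ∑ (allFin r) (λ v → 1 ∸ toℕ v) ≤ 1
    ∑-1∸≤ zero    = z≤n
    ∑-1∸≤ (suc r) = ≤-reflexive (∑-1∸ r)
  ... | true = begin
    ∑ (allFin r) (λ v → Q * inside a b (suc (toℕ v)) + 1)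
      ≡⟨ trans (∑-+ (allFin r) _ _) (cong₂ _+_ (∑-* (allFin r) Q _)
           (trans (∑-const (allFin r) 1) (trans (*-identityʳ _) (length-allFin r)))) ⟩
    Q * ∑ (allFin r) (λ v → inside a b (suc (toℕ v))) + r
      ≤⟨ +-monoˡ-≤ r (*-monoʳ-≤ Q (≤-trans (m≤n+m _ (inside a b 0))
           (≤-trans (≤-reflexive (sym (∑-allFin-suc r (λ v → inside a b (toℕ v))))) (∑-inside≤ (suc r) a b)))) ⟩
    Q * size c x y + r
      ≡⟨ sym (*-identityʳ _) ⟩
    (Q * size c x y + r) ^ 1 ∎
    where
    open ≤-Reasoning
    a = lo c x y
    b = hi c x y

  ∑-total : ∀ c → ∑ (tables n r) (total c) ≤ ∏² V (λ x y → (Q * size c x y + r) ^ ordered x y)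
  ∑-total c = ≤-trans (≤-reflexive (∑-tables n r (weight c))) (∏²-mono V (∑-weight c))

  -- A pair within its interval contributes Q + 1; an exceptional pair contributes at least 1, and
  -- its missing factor Q is supplied by the power of Q in front.
  total-≥ : ∀ c (d : Table n r) (D : Fin n → Fin n → ℕ) → (∀ x y → D x y ≡ dist d x y) → Normalised d →
    (∀ x y → D x y ≤ hi c x y) →
    Q ^ ∑² V ordered ≤ Q ^ ∑² V (λ x y → lt (D x y) (lo c x y)) * total c d
  total-≥ c d D D≡ normal D≤hi = begin
    Q ^ ∑² V ordered                 ≡⟨ sym (∏²-^ V Q ordered) ⟩
    ∏² V (λ x y → Q ^ ordered x y)   ≤⟨ ∏²-mono V pointwise ⟩
    ∏² V (λ x y → Q ^ e x y * weight c x y (d x y))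
      ≡⟨ trans (∏²-* V _ _) (cong (_* total c d) (∏²-^ V Q e)) ⟩
    Q ^ ∑² V e * total c d           ∎
    where
    open ≤-Reasoning
    e : Fin n → Fin n → ℕ
    e x y = lt (D x y) (lo c x y)
    pointwise : ∀ x y → Q ^ ordered x y ≤ Q ^ e x y * weight c x y (d x y)
    pointwise x y with toℕ x <? toℕ y
    ... | no ¬p rewrite <ᵇ-false (≮⇒≥ ¬p) | normal x y (≮⇒≥ ¬p) = ≤-trans (1≤^ (e x y) 1≤Q) (≤-reflexive (sym (*-identityʳ _)))
    ... | yes p with D x y <? lo c x y
    ...   | yes q rewrite <ᵇ-true p | lt≡1 q = ≤-trans (≤-reflexive (sym (*-identityʳ (Q * 1)))) (*-monoʳ-≤ (Q * 1) (m≤n+m 1 _))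
    ...   | no ¬q rewrite <ᵇ-true p | lt≡0 ¬q
                        | inside≡1 {lo c x y} {hi c x y} {suc (toℕ (d x y))}
                            (subst (lo c x y ≤_) (trans (D≡ x y) (dist-< d p)) (≮⇒≥ ¬q))
                            (subst (_≤ hi c x y) (trans (D≡ x y) (dist-< d p)) (D≤hi x y))
      = ≤-trans (m≤m+n (Q * 1) 1) (≤-reflexive (sym (*-identityˡ _)))

module Count {n r m L j : ℕ} (1≤r : 1 ≤ r) (1≤m : 1 ≤ m) (r<2m : r < 2 * m) (1≤j : 1 ≤ j)
  (L*m≡2*j : L * m ≡ 2 * j) (1≤L : 1 ≤ L) where

  -- With `Q = r * L` a pair has total weight Q · size + r = r (L · size + 1) = Q (size + 1/L), so
  -- the weighting lengthens each interval by only 1/L.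
  h Q N K : ℕ
  h = L * L
  Q = r * L
  N = ∑² (allFin n) ordered
  K = 4 * (h * h * h) * (r * r * r)

  module _ (cap : ℕ) (cap≡ : cap ≡ L * (m * (n * n)) + 76 * (m * (n * n))) (L≤n : L ≤ n) (k q : ℕ)
    (k-large : 2 * (n * n) < h * suc k) (q-large : L * n + 77 * (n * n) ≤ L * q) where

    V = allFin n

    1≤n : 1 ≤ n
    1≤n = ≤-trans 1≤L L≤n
    1≤h : 1 ≤ h
    1≤h = *-mono-≤ 1≤L 1≤L
    1≤Q : 1 ≤ Q
    1≤Q = *-mono-≤ 1≤r 1≤L

    open Weight {n} {r} Q 1≤Q using (total; ∑-total; total-≥)

    -- All certificates are enumerated, including some with long intervals that belong to no metric.
    -- Those get weight 0; the certificate found for a metric passes, by `∑-size-bound`.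
    gate : Certificate n r → ℕ
    gate c = lt (L * ∑² V (size c)) (suc cap)

    module _ (d : Table n r) (metric : IsMetric d) where

      open Container {n} {r} {m} {h} 1≤n 1≤r 1≤h r<2m (rowVectors d) using (D; exceptions; certificate; ∑misfit-bound; I)

      D-sym : ∀ x y → D x y ≡ D y x
      D-sym x y = trans (row-dist d x y) (trans (dist-sym d x y) (sym (row-dist d y x)))

      D-triangle : ∀ x y z → D x y ≤ D z x + D z y
      D-triangle x y z = ≤-trans (≤-reflexive (row-dist d x y)) (≤-trans (dist-triangle d metric x y z)
        (≤-reflexive (sym (cong₂ _+_ (row-dist d z x) (row-dist d z y)))))

      weight-≥ : ∀ c (above : ∀ x y → D x y ≤ hi c x y) → h * exceptions c ≤ 2 * (n * n) →
        h * ∑³ V (I c above) ≤ 3 * (n * (n * n)) → Q ^ N ≤ Q ^ k * (gate c * total c d)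
      weight-≥ c above rare few = begin
        Q ^ N                         ≤⟨ total-≥ c d D (row-dist d) (proj₁ metric) above ⟩
        Q ^ exceptions c * total c d  ≤⟨ *-monoˡ-≤ (total c d) (^-monoʳ-≤ Q {{>-nonZero 1≤Q}} exc≤k) ⟩
        Q ^ k * total c d             ≡⟨ cong (Q ^ k *_) (sym (trans (cong (_* total c d) (lt≡1 (s≤s sizes))) (*-identityˡ _))) ⟩
        Q ^ k * (gate c * total c d)  ∎
        where
        open ≤-Reasoning
        exc≤k : exceptions c ≤ k
        exc≤k = ≤-pred (*-cancelˡ-< h (exceptions c) (suc k) (≤-<-trans rare k-large))
        size≤ : ∀ x y → size c x y ≤ 2 * m
        size≤ x y = ≤-trans (m∸n≤m (suc (hi c x y)) (lo c x y)) (≤-trans (s≤s (upper≤r (proj₁ c) x y)) r<2m)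
        sizes : L * ∑² V (size c) ≤ cap
        sizes = subst (L * ∑² V (size c) ≤_) (sym cap≡)
          (∑-size-bound {n} {m} {L} (size c) (size-sym c) size≤ 1≤n 1≤L L≤n (∑misfit-bound c above rare few))

      covered : ∃[ c ] c ∈ certificates n r K × Q ^ N ≤ Q ^ k * (gate c * total c d)
      covered = extract (certificate D-sym D-triangle)
        where
        extract : ∃[ c ] (length (proj₁ c) ≤ K × length (proj₁ (proj₂ c)) ≤ K × length (proj₂ (proj₂ c)) ≤ K)
          × (∀ x y → D x y ≤ hi c x y) × h * exceptions c ≤ 2 * (n * n)
          × h * ∑³ V (λ x y z → lt (lo c x z + lo c y z) (hi c x y)) ≤ 3 * (n * (n * n)) →
          ∃[ c ] c ∈ certificates n r K × Q ^ N ≤ Q ^ k * (gate c * total c d)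
        extract (c , (lenZ , lenT , lenT′) , above , rare , few) =
          c , ∈-certificates K c lenZ lenT lenT′ , weight-≥ c above rare few

    -- 77 = 76 + 1, the 1 being the summand in `L * size c x y + 1`. The term `L * n` in `q-large`
    -- arises from replacing n² by twice the number of pairs plus n.
    U-bound : ∀ (c : Certificate n r) → L * ∑² V (size c) ≤ cap →
      ∑² V (λ x y → ordered x y * (L * size c x y + 1)) ≤ 2 * j * ∑² V ordered + j * q
    U-bound c ok = *-cancelˡ-≤ 2 (begin
      2 * ∑² V (λ x y → ordered x y * (L * size c x y + 1))
        ≤⟨ ∑²-ordered-sym (λ x y → L * size c x y + 1) (λ x y → cong (λ t → L * t + 1) (size-sym c x y)) ⟩
      ∑² V (λ x y → L * size c x y + 1)
        ≡⟨ trans (∑²-+ V _ _) (cong₂ _+_ (∑²-* V L (size c))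
             (trans (∑²-const V 1) (cong (λ t → t * (t * 1)) (length-allFin n)))) ⟩
      L * ∑² V (size c) + n * (n * 1)
        ≤⟨ +-mono-≤ ok (≤-trans (≤-reflexive (cong (n *_) (*-identityʳ n))) (m≤m*n (n * n) m {{>-nonZero 1≤m}})) ⟩
      cap + n * n * m
        ≡⟨ trans (cong (_+ n * n * m) cap≡) (e₁ L m (n * n)) ⟩
      L * m * (n * n) + m * (77 * (n * n))
        ≡⟨ cong (λ t → L * m * t + m * (77 * (n * n))) (sym (2*∑²-ordered n)) ⟩
      L * m * (2 * O + n) + m * (77 * (n * n))
        ≡⟨ e₂ L m O n ⟩
      2 * (L * m * O) + m * (L * n + 77 * (n * n))
        ≤⟨ +-monoʳ-≤ (2 * (L * m * O)) (*-monoʳ-≤ m q-large) ⟩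
      2 * (L * m * O) + m * (L * q)
        ≡⟨ cong (λ t → 2 * (t * O) + m * (L * q)) L*m≡2*j ⟩
      2 * (2 * j * O) + m * (L * q)
        ≡⟨ cong (2 * (2 * j * O) +_) (trans (e₃ m L q) (trans (cong (_* q) L*m≡2*j) (*-assoc 2 j q))) ⟩
      2 * (2 * j * O) + 2 * (j * q)
        ≡⟨ sym (*-distribˡ-+ 2 (2 * j * O) (j * q)) ⟩
      2 * (2 * j * O + j * q) ∎)
      where
      open ≤-Reasoning
      O = ∑² V ordered
      e₁ : ∀ L m a → L * (m * a) + 76 * (m * a) + a * m ≡ L * m * a + m * (77 * a)
      e₁ = solve-∀
      e₂ : ∀ L m O n → L * m * (2 * O + n) + m * (77 * (n * n)) ≡ 2 * (L * m * O) + m * (L * n + 77 * (n * n))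
      e₂ = solve-∀
      e₃ : ∀ m L q → m * (L * q) ≡ L * m * q
      e₃ = solve-∀

    gated-total : ∀ c → gate c * ∑ (tables n r) (total c) ≤ Q ^ N * (m ^ N * 2 ^ q)
    gated-total c = split (L * ∑² V (size c) ≤? cap)
      where
      open ≤-Reasoning
      split : Dec (L * ∑² V (size c) ≤ cap) → gate c * ∑ (tables n r) (total c) ≤ Q ^ N * (m ^ N * 2 ^ q)
      split (no ¬ok) = ≤-trans (≤-reflexive (cong (_* ∑ (tables n r) (total c)) (lt≡0 (λ p → ¬ok (≤-pred p))))) z≤n
      split (yes ok) = begin
        gate c * ∑ (tables n r) (total c)
          ≡⟨ trans (cong (_* ∑ (tables n r) (total c)) (lt≡1 (s≤s ok))) (*-identityˡ _) ⟩
        ∑ (tables n r) (total c)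
          ≤⟨ ∑-total c ⟩
        ∏² V (λ x y → (Q * size c x y + r) ^ ordered x y)
          ≡⟨ ∏²-cong V (λ x y → trans (cong (_^ ordered x y) (e₁ r L (size c x y))) (^-distrib-* r (L * size c x y + 1) (ordered x y))) ⟩
        ∏² V (λ x y → r ^ ordered x y * (L * size c x y + 1) ^ ordered x y)
          ≡⟨ trans (∏²-* V _ _) (cong (_* ∏² V (λ x y → (L * size c x y + 1) ^ ordered x y)) (∏²-^ V r ordered)) ⟩
        r ^ ∑² V ordered * ∏² V (λ x y → (L * size c x y + 1) ^ ordered x y)
          ≤⟨ *-monoʳ-≤ (r ^ ∑² V ordered) (amgm-even V ordered (λ x y → L * size c x y + 1) j q 1≤j (U-bound c ok)) ⟩
        r ^ ∑² V ordered * ((2 * j) ^ ∑² V ordered * 2 ^ q)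
          ≡⟨ cong (λ t → r ^ N * (t ^ N * 2 ^ q)) (sym L*m≡2*j) ⟩
        r ^ N * ((L * m) ^ N * 2 ^ q)
          ≡⟨ cong (λ t → r ^ N * (t * 2 ^ q)) (^-distrib-* L m N) ⟩
        r ^ N * (L ^ N * m ^ N * 2 ^ q)
          ≡⟨ e₂ (r ^ N) (L ^ N) (m ^ N) (2 ^ q) ⟩
        r ^ N * L ^ N * (m ^ N * 2 ^ q)
          ≡⟨ cong (_* (m ^ N * 2 ^ q)) (sym (^-distrib-* r L N)) ⟩
        Q ^ N * (m ^ N * 2 ^ q) ∎
        where
        e₁ : ∀ r L s → r * L * s + r ≡ r * (L * s + 1)
        e₁ = solve-∀
        e₂ : ∀ a b c d → a * (b * c * d) ≡ a * b * (c * d)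
        e₂ = solve-∀

    -- Double counting of weights: `Q ^ N` occurs both in the weight of each metric and in the total
    -- of each certificate, and cancels. The remaining factors are the number of certificates, the
    -- cost of exceptional pairs, and the AM-GM bound.
    numMetrics-≤ : numMetrics n r ≤ suc (n * r ^ n) ^ (3 * K) * (Q ^ k * (m ^ N * 2 ^ q))
    numMetrics-≤ = *-cancelʳ-≤ (numMetrics n r) _ (Q ^ N) {{>-nonZero (1≤^ N 1≤Q)}} (begin
      numMetrics n r * Q ^ N
        ≤⟨ double-count {P = IsMetric} isMetric? (tables n r) cs (λ c d → Q ^ k * (gate c * total c d)) covered weigh ⟩
      length cs * (Q ^ k * (Q ^ N * (m ^ N * 2 ^ q)))
        ≤⟨ *-monoˡ-≤ (Q ^ k * (Q ^ N * (m ^ N * 2 ^ q))) (length-certificates n r K) ⟩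
      suc (n * r ^ n) ^ (3 * K) * (Q ^ k * (Q ^ N * (m ^ N * 2 ^ q)))
        ≡⟨ e (suc (n * r ^ n) ^ (3 * K)) (Q ^ k) (Q ^ N) (m ^ N * 2 ^ q) ⟩
      suc (n * r ^ n) ^ (3 * K) * (Q ^ k * (m ^ N * 2 ^ q)) * Q ^ N ∎)
      where
      open ≤-Reasoning
      cs = certificates n r K
      weigh : ∀ c → ∑ (tables n r) (λ d → Q ^ k * (gate c * total c d)) ≤ Q ^ k * (Q ^ N * (m ^ N * 2 ^ q))
      weigh c = ≤-trans
        (≤-reflexive (trans (∑-* (tables n r) (Q ^ k) (λ d → gate c * total c d))
          (cong (Q ^ k *_) (∑-* (tables n r) (gate c) (total c)))))
        (*-monoʳ-≤ (Q ^ k) (gated-total c))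
      e : ∀ a b c d → a * (b * (c * d)) ≡ a * (b * d) * c
      e = solve-∀

-- Asymptotics

n<2^n : ∀ n → n < 2 ^ n
n<2^n zero    = s≤s z≤n
n<2^n (suc n) = ≤-trans (+-mono-≤ (1≤^ n (s≤s (z≤n {1}))) (n<2^n n)) (≤-reflexive (cong (2 ^ n +_) (sym (+-identityʳ _))))

⌈r+1/2⌉-bounds : ∀ r → r < 2 * ⌈ r + 1 /2⌉ × 2 * ⌈ r + 1 /2⌉ ≤ r + 2
⌈r+1/2⌉-bounds zero          = s≤s z≤n , ≤-refl
⌈r+1/2⌉-bounds (suc zero)    = ≤-refl , n≤1+n 2
⌈r+1/2⌉-bounds (suc (suc r)) with ⌈r+1/2⌉-bounds r
... | p , q = ≤-trans (s≤s (s≤s p)) (≤-reflexive (sym (*-suc 2 ⌈ r + 1 /2⌉))) ,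
              ≤-trans (≤-reflexive (*-suc 2 ⌈ r + 1 /2⌉)) (s≤s (s≤s q))

module UpperBound {n r m b l : ℕ} (1≤r : 1 ≤ r) (2≤m : 2 ≤ m) (r<2m : r < 2 * m) where

  L h K N : ℕ
  L = 2 ^ suc l
  h = L * L
  K = 4 * (h * h * h) * (r * r * r)
  N = ∑² (allFin n) ordered

  module _ (b≤L : 237 * b ≤ L) (l≤L : suc l + 2 ≤ L) (L≤n : L ≤ n) (K≤n : 36 * b * K ≤ n) where

    1≤L : 1 ≤ L
    1≤L = 1≤^ (suc l) (s≤s (z≤n {1}))

    1≤n : 1 ≤ n
    1≤n = ≤-trans 1≤L L≤n

    1≤m : 1 ≤ m
    1≤m = ≤-trans (s≤s z≤n) 2≤m

    instance
      m≢0 : NonZero m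
      m≢0 = >-nonZero 1≤m
      L≢0 : NonZero L
      L≢0 = >-nonZero 1≤L
      h≢0 : NonZero h
      h≢0 = >-nonZero (*-mono-≤ 1≤L 1≤L)

    r≤m² : r ≤ m * m
    r≤m² = ≤-trans (<⇒≤ r<2m) (*-monoˡ-≤ m 2≤m)

    -- n < 2^n ≤ m^n and r^n ≤ m^(2n) account for exponent 3n; the last n pays for the successor,
    -- through 2 ≤ m ≤ m^n.
    landmark-cost : suc (n * r ^ n) ≤ m ^ (4 * n)
    landmark-cost = begin
      suc (n * r ^ n)          ≤⟨ s≤s (*-mono-≤ (≤-trans (<⇒≤ (n<2^n n)) (^-monoˡ-≤ n 2≤m)) (^-monoˡ-≤ n r≤m²)) ⟩
      suc (s * (m * m) ^ n)    ≡⟨ cong (λ t → suc (s * t)) (^-distrib-* m m n) ⟩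
      1 + s * (s * s)          ≤⟨ +-monoˡ-≤ _ (*-mono-≤ 1≤s (*-mono-≤ 1≤s 1≤s)) ⟩
      s * (s * s) + s * (s * s) ≡⟨ cong (s * (s * s) +_) (sym (+-identityʳ _)) ⟩
      2 * (s * (s * s))        ≤⟨ *-monoˡ-≤ (s * (s * s)) (≤-trans 2≤m m≤s) ⟩
      s * (s * (s * s))        ≡⟨ cong (λ t → s * (s * (s * t))) (sym (*-identityʳ s)) ⟩
      s ^ 4                    ≡⟨ ^-*-assoc m n 4 ⟩
      m ^ (n * 4)              ≡⟨ cong (m ^_) (*-comm n 4) ⟩
      m ^ (4 * n)              ∎
      where
      open ≤-Reasoning
      s = m ^ n
      1≤s : 1 ≤ s
      1≤s = 1≤^ n 1≤m
      m≤s : m ≤ s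
      m≤s = ≤-trans (≤-reflexive (sym (*-identityʳ m))) (^-monoʳ-≤ m 1≤n)

    Q-cost : r * L ≤ m ^ (suc l + 2)
    Q-cost = begin
      r * L                    ≤⟨ *-mono-≤ r≤m² (^-monoˡ-≤ (suc l) 2≤m) ⟩
      m * m * m ^ suc l        ≡⟨ *-comm (m * m) _ ⟩
      m ^ suc l * (m * m)      ≡⟨ cong (λ t → m ^ suc l * (m * t)) (sym (*-identityʳ m)) ⟩
      m ^ suc l * m ^ 2        ≡⟨ sym (^-distribˡ-+-* m (suc l) 2) ⟩
      m ^ (suc l + 2)          ∎
      where open ≤-Reasoning

    L²≤n² : L * L ≤ n * n
    L²≤n² = *-mono-≤ L≤n L≤n

    -- Each error gets a third of n². Landmarks need 36 b K ≤ n; exceptional pairs need 9 b (l + 3)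
    -- ≤ L², as h k ≤ 3 n²; the length excess needs 3 b (1 + 1 + 77) = 237 b ≤ L.
    exponent : ∀ k q → h * k ≤ 2 * (n * n) + h → L * q ≤ L * n + L + 77 * (n * n) →
      b * (4 * n * (3 * K) + (suc l + 2) * k + q) ≤ n * n
    exponent k q hk Lq = *-cancelˡ-≤ 3 (begin
      3 * (b * (4 * n * (3 * K) + (suc l + 2) * k + q))
        ≡⟨ e b n K (suc l + 2) k q ⟩
      n * (36 * b * K) + 3 * b * ((suc l + 2) * k) + 3 * b * q
        ≤⟨ +-mono-≤ (+-mono-≤ (*-monoʳ-≤ n K≤n) k-part) q-part ⟩
      n * n + n * n + n * n
        ≡⟨ e′ (n * n) ⟩
      3 * (n * n) ∎)
      where
      open ≤-Reasoning
      e : ∀ b n K l k q → 3 * (b * (4 * n * (3 * K) + l * k + q)) ≡ n * (36 * b * K) + 3 * b * (l * k) + 3 * b * q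
      e = solve-∀
      e′ : ∀ a → a + a + a ≡ 3 * a
      e′ = solve-∀
      k-part : 3 * b * ((suc l + 2) * k) ≤ n * n
      k-part = *-cancelˡ-≤ h (begin
        h * (3 * b * ((suc l + 2) * k))       ≡⟨ e₁ h b (suc l + 2) k ⟩
        3 * b * (suc l + 2) * (h * k)         ≤⟨ *-monoʳ-≤ (3 * b * (suc l + 2)) (≤-trans hk (+-monoʳ-≤ (2 * (n * n)) L²≤n²)) ⟩
        3 * b * (suc l + 2) * (2 * (n * n) + n * n) ≡⟨ e₂ b (suc l + 2) (n * n) ⟩
        9 * b * (suc l + 2) * (n * n)         ≤⟨ *-monoˡ-≤ (n * n) (*-mono-≤ (≤-trans (*-monoˡ-≤ b 9≤237) b≤L) l≤L) ⟩
        h * (n * n)                           ∎)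
        where
        9≤237 : 9 ≤ 237
        9≤237 = m≤m+n 9 228
        e₁ : ∀ h b l k → h * (3 * b * (l * k)) ≡ 3 * b * l * (h * k)
        e₁ = solve-∀
        e₂ : ∀ b l a → 3 * b * l * (2 * a + a) ≡ 9 * b * l * a
        e₂ = solve-∀
      q-part : 3 * b * q ≤ n * n
      q-part = *-cancelˡ-≤ L (begin
        L * (3 * b * q)                       ≡⟨ e₁ L b q ⟩
        3 * b * (L * q)                       ≤⟨ *-monoʳ-≤ (3 * b) (≤-trans Lq (+-monoˡ-≤ (77 * (n * n)) (+-mono-≤ (*-monoˡ-≤ n L≤n) (≤-trans L≤n (m≤m*n n n {{>-nonZero 1≤n}}))))) ⟩
        3 * b * (n * n + n * n + 77 * (n * n)) ≡⟨ e₂ b (n * n) ⟩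
        237 * b * (n * n)                     ≤⟨ *-monoˡ-≤ (n * n) b≤L ⟩
        L * (n * n)                           ∎)
        where
        e₁ : ∀ L b q → L * (3 * b * q) ≡ 3 * b * (L * q)
        e₁ = solve-∀
        e₂ : ∀ b a → 3 * b * (a + a + 77 * a) ≡ 237 * b * a
        e₂ = solve-∀

    numMetrics-^-≤ : numMetrics n r ^ b ≤ m ^ (b * N + n * n)
    numMetrics-^-≤ =
      let (γ , γ≤ , ≤γ) = floor (2 * (n * n)) h (*-mono-≤ 1≤L 1≤L)
          (δ , δ≤ , ≤δ) = floor (77 * (n * n)) L 1≤L
      -- `floor` yields only 2 n² ≤ h (γ + 1); taking k = γ + 1 provides the strict inequality. In
      -- q, the summand n covers `L * n` and δ + 1 covers 77 n².
      in conclude (suc γ) (n + suc δ)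
        (≤-trans (s≤s ≤γ) (≤-trans (+-monoˡ-≤ (h * suc γ) (*-mono-≤ 1≤L 1≤L)) (≤-reflexive (sym (*-suc h (suc γ))))))
        (≤-trans (+-monoʳ-≤ (L * n) ≤δ) (≤-reflexive (sym (*-distribˡ-+ L n (suc δ)))))
        (≤-trans (≤-reflexive (trans (*-suc h γ) (+-comm h (h * γ)))) (+-monoˡ-≤ h γ≤))
        (≤-trans (≤-reflexive (e L n δ)) (+-monoʳ-≤ (L * n + L) δ≤))
      where
      e : ∀ L n δ → L * (n + suc δ) ≡ L * n + L + L * δ
      e = solve-∀
      open ≤-Reasoning
      conclude : ∀ k q → 2 * (n * n) < h * suc k → L * n + 77 * (n * n) ≤ L * q → h * k ≤ 2 * (n * n) + h →
        L * q ≤ L * n + L + 77 * (n * n) → numMetrics n r ^ b ≤ m ^ (b * N + n * n)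
      conclude k q k-large q-large hk Lq = begin
        numMetrics n r ^ b
          ≤⟨ ^-monoˡ-≤ b (Count.numMetrics-≤ {j = 2 ^ l * m} 1≤r 1≤m r<2m (*-mono-≤ (1≤^ l (s≤s (z≤n {1}))) 1≤m)
               (*-assoc 2 (2 ^ l) m) 1≤L _ refl L≤n k q k-large q-large) ⟩
        (suc (n * r ^ n) ^ (3 * K) * ((r * L) ^ k * (m ^ N * 2 ^ q))) ^ b
          ≤⟨ ^-monoˡ-≤ b (*-mono-≤ (^-monoˡ-≤ (3 * K) landmark-cost)
               (*-mono-≤ (^-monoˡ-≤ k Q-cost) (*-monoʳ-≤ (m ^ N) (^-monoˡ-≤ q 2≤m)))) ⟩
        ((m ^ (4 * n)) ^ (3 * K) * ((m ^ (suc l + 2)) ^ k * (m ^ N * m ^ q))) ^ b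
          ≡⟨ cong (_^ b) (cong₂ _*_ (^-*-assoc m (4 * n) (3 * K))
               (cong₂ _*_ (^-*-assoc m (suc l + 2) k) (sym (^-distribˡ-+-* m N q)))) ⟩
        (m ^ (4 * n * (3 * K)) * (m ^ ((suc l + 2) * k) * m ^ (N + q))) ^ b
          ≡⟨ cong (_^ b) (trans (cong (m ^ (4 * n * (3 * K)) *_) (sym (^-distribˡ-+-* m ((suc l + 2) * k) (N + q))))
               (sym (^-distribˡ-+-* m (4 * n * (3 * K)) ((suc l + 2) * k + (N + q))))) ⟩
        (m ^ (4 * n * (3 * K) + ((suc l + 2) * k + (N + q)))) ^ b
          ≡⟨ ^-*-assoc m (4 * n * (3 * K) + ((suc l + 2) * k + (N + q))) b ⟩
        m ^ ((4 * n * (3 * K) + ((suc l + 2) * k + (N + q))) * b)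
          ≡⟨ cong (m ^_) (regroup (4 * n * (3 * K)) ((suc l + 2) * k) N q b) ⟩
        m ^ (b * N + b * (4 * n * (3 * K) + (suc l + 2) * k + q))
          ≤⟨ ^-monoʳ-≤ m (+-monoʳ-≤ (b * N) (exponent k q hk Lq)) ⟩
        m ^ (b * N + n * n) ∎
        where
        regroup : ∀ x y N q b → (x + (y + (N + q))) * b ≡ b * N + b * (x + y + q)
        regroup = solve-∀

-- If n < D r³, then n^q ≤ D^q r^(3q), and the growth condition bounds a positive power of log n by
-- B D^q. This is impossible from n = 2^t on, where t = B D^q + 1.
cube-eventually-small : (p q : ℕ) → 1 ≤ q → (r : ℕ → ℕ) → (∀ n → 1 ≤ r n) →
  (∃[ B ] ∃[ n₀ ] ∀ n → n₀ ≤ n → r n ^ (3 * q) * ⌊log₂ n ⌋ ^ (4 * q + 3 * p) ≤ B * n ^ q) →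
  ∀ D → ∃[ N ] ∀ n → N ≤ n → D * (r n * r n * r n) ≤ n
cube-eventually-small p q 1≤q r 1≤r (B , n₀ , growth) D = n₀ ⊔ 2 ^ t , λ n N≤n →
  ≮⇒≥ λ n<Dr³ → <⇒≱ (smaller n) (contra n (≤-trans (m≤m⊔n n₀ (2 ^ t)) N≤n) (≤-trans (m≤n⊔m n₀ (2 ^ t)) N≤n) n<Dr³)
  where
  open ≤-Reasoning
  t = suc (B * D ^ q)
  smaller : ∀ n → r n ^ (3 * q) * (B * D ^ q) < r n ^ (3 * q) * t
  smaller n = *-monoʳ-< (r n ^ (3 * q)) {{>-nonZero (1≤^ (3 * q) (1≤r n))}} ≤-refl
  contra : ∀ n → n₀ ≤ n → 2 ^ t ≤ n → n < D * (r n * r n * r n) →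
    r n ^ (3 * q) * t ≤ r n ^ (3 * q) * (B * D ^ q)
  contra n n₀≤n 2^t≤n n<Dr³ = begin
    r n ^ (3 * q) * t                               ≤⟨ *-monoʳ-≤ (r n ^ (3 * q)) t≤log^ ⟩
    r n ^ (3 * q) * ⌊log₂ n ⌋ ^ (4 * q + 3 * p)     ≤⟨ growth n n₀≤n ⟩
    B * n ^ q                                       ≤⟨ *-monoʳ-≤ B (^-monoˡ-≤ q (<⇒≤ n<Dr³)) ⟩
    B * (D * (r n * r n * r n)) ^ q                 ≡⟨ cong (B *_) (^-distrib-* D _ q) ⟩
    B * (D ^ q * (r n * r n * r n) ^ q)             ≡⟨ cong (λ s → B * (D ^ q * s)) (trans (cong (_^ q) (e₁ (r n))) (^-*-assoc (r n) 3 q)) ⟩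
    B * (D ^ q * r n ^ (3 * q))                     ≡⟨ e₂ B (D ^ q) (r n ^ (3 * q)) ⟩
    r n ^ (3 * q) * (B * D ^ q)                     ∎
    where
    e₁ : ∀ a → a * a * a ≡ a * (a * (a * 1))
    e₁ = solve-∀
    e₂ : ∀ a b c → a * (b * c) ≡ c * (a * b)
    e₂ = solve-∀
    t≤log : t ≤ ⌊log₂ n ⌋
    t≤log = ≤-trans (≤-reflexive (sym (⌊log₂[2^n]⌋≡n t))) (⌊log₂⌋-mono-≤ 2^t≤n)
    1≤exponent : 1 ≤ 4 * q + 3 * p
    1≤exponent = ≤-trans (*-mono-≤ (s≤s (z≤n {3})) 1≤q) (m≤m+n (4 * q) (3 * p))
    t≤log^ : t ≤ ⌊log₂ n ⌋ ^ (4 * q + 3 * p)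
    t≤log^ = ≤-trans t≤log (≤-trans (≤-reflexive (sym (*-identityʳ _)))
      (^-monoʳ-≤ ⌊log₂ n ⌋ {{>-nonZero (≤-trans (s≤s z≤n) t≤log)}} 1≤exponent))

-- Real exponents are cleared with ε = p/q: the 3q-th power of the condition on r has log exponent
-- 3q (4/3 + p/q) = 4q + 3p. The term o(n²) becomes an error of at most (a/b) n² in either direction
-- for each positive rational a/b and all large n; taking b-th powers clears the denominator.
theorem3p1 : (p q : ℕ) → 1 ≤ p → 1 ≤ q →
    (r : ℕ → ℕ) → (∀ n → 1 ≤ r n) →
    (∃[ C ] ∃[ n₀ ] ∀ n → n₀ ≤ n →
    r n ^ (3 * q) * ⌊log₂ n ⌋ ^ (4 * q + 3 * p) ≤ C * n ^ q) →
    (a b : ℕ) → 1 ≤ a → 1 ≤ b →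
    ∃[ N ] ∀ n → N ≤ n →
    (numMetrics n (r n) ^ b ≤ ⌈ r n + 1 /2⌉ ^ (b * (n C 2) + a * (n * n)))
    × (⌈ r n + 1 /2⌉ ^ (b * (n C 2)) ≤ numMetrics n (r n) ^ b * ⌈ r n + 1 /2⌉ ^ (a * (n * n)))
theorem3p1 p q _ 1≤q r 1≤r growth a b 1≤a 1≤b =
  -- The constant is that of 36 b K ≤ n, with K = 4 h³ r³.
  let (N , small) = cube-eventually-small p q 1≤q r 1≤r growth (36 * b * (4 * (h * h * h)))
  in N ⊔ L , λ n N≤n →
    upper-bound n (r n) (1≤r n) (≤-trans (m≤n⊔m N L) N≤n) (small n (≤-trans (m≤m⊔n N L) N≤n)) ,
    lower-bound n (r n) (1≤r n)
  where
  open ≤-Reasoning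
  -- Since 2^l > l, this makes `L` at least 237 b. A power of two makes L m even, as `amgm-even`
  -- requires, and gives L ≤ m^(l+1).
  l = 237 * b
  L = 2 ^ suc l
  h = L * L

  l<2^l : l < 2 ^ l
  l<2^l = n<2^n l

  b≤L : 237 * b ≤ L
  b≤L = ≤-trans (<⇒≤ l<2^l) (m≤m+n (2 ^ l) _)

  l≤L : suc l + 2 ≤ L
  l≤L = +-mono-≤ l<2^l (≤-trans (≤-trans (s≤s (≤-trans 1≤b (m≤n*m b 237))) l<2^l)
    (≤-reflexive (sym (+-identityʳ (2 ^ l)))))

  1≤⌈⌉ : ∀ s → 1 ≤ ⌈ s + 1 /2⌉
  1≤⌈⌉ s = ≤-trans (s≤s (z≤n {⌊ s /2⌋})) (≤-reflexive (cong ⌈_/2⌉ (+-comm 1 s)))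

  upper-bound : ∀ n s → 1 ≤ s → L ≤ n → 36 * b * (4 * (h * h * h)) * (s * s * s) ≤ n →
    numMetrics n s ^ b ≤ ⌈ s + 1 /2⌉ ^ (b * (n C 2) + a * (n * n))
  -- For r = 1 the base is 1, so no error term can absorb a loss and the count must be bounded
  -- exactly.
  upper-bound n 1 _ _ _ = ≤-trans (^-monoˡ-≤ b (numMetrics-1≤1 n))
    (≤-reflexive (trans (^-zeroˡ b) (sym (^-zeroˡ (b * (n C 2) + a * (n * n))))))
  upper-bound n s@(suc (suc s′)) 1≤s L≤n small = ≤-trans
    (UpperBound.numMetrics-^-≤ {n} {s} {⌈ s + 1 /2⌉} {b} {l} 1≤s 2≤m (proj₁ (⌈r+1/2⌉-bounds s)) b≤L l≤L L≤n
      (≤-trans (≤-reflexive (sym (*-assoc (36 * b) (4 * (h * h * h)) (s * s * s)))) small))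
    (^-monoʳ-≤ ⌈ s + 1 /2⌉ {{>-nonZero (1≤⌈⌉ s)}} (+-mono-≤ (≤-reflexive (cong (b *_) (∑²-ordered n)))
      (m≤n*m (n * n) a {{>-nonZero 1≤a}})))
    where
    2≤m : 2 ≤ ⌈ s + 1 /2⌉
    2≤m = s≤s (1≤⌈⌉ s′)

  lower-bound : ∀ n s → 1 ≤ s →
    ⌈ s + 1 /2⌉ ^ (b * (n C 2)) ≤ numMetrics n s ^ b * ⌈ s + 1 /2⌉ ^ (a * (n * n))
  lower-bound n s 1≤s = begin
    m ^ (b * (n C 2))                    ≡⟨ cong (m ^_) (*-comm b (n C 2)) ⟩
    m ^ ((n C 2) * b)                    ≡⟨ sym (^-*-assoc m (n C 2) b) ⟩
    (m ^ (n C 2)) ^ b                    ≤⟨ ^-monoˡ-≤ b (numMetrics-≥ n s m 1≤s m≤s s≤) ⟩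
    numMetrics n s ^ b                   ≤⟨ m≤m*n _ (m ^ (a * (n * n))) {{>-nonZero (1≤^ (a * (n * n)) (1≤⌈⌉ s))}} ⟩
    numMetrics n s ^ b * m ^ (a * (n * n)) ∎
    where
    m = ⌈ s + 1 /2⌉
    2m≤s+2 : 2 * m ≤ s + 2
    2m≤s+2 = proj₂ (⌈r+1/2⌉-bounds s)
    m≤s : m ≤ s
    m≤s = ≮⇒≥ λ s<m → <⇒≱ (begin-strict
      s + 2           <⟨ +-monoˡ-≤ (s + 2) 1≤s ⟩
      s + (s + 2)     ≡⟨ e s ⟩
      2 * suc s       ≤⟨ *-monoʳ-≤ 2 s<m ⟩
      2 * m           ∎) 2m≤s+2
      where
      e : ∀ s → s + (s + 2) ≡ 2 * suc s
      e = solve-∀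
    s≤ : s ≤ 2 * suc (s ∸ m)
    s≤ = +-cancelʳ-≤ s _ _ (begin
      s + s                     ≡⟨ cong₂ _+_ eq eq ⟩
      (t + m) + (t + m)         ≡⟨ e₁ t m ⟩
      2 * t + 2 * m             ≤⟨ +-monoʳ-≤ (2 * t) 2m≤s+2 ⟩
      2 * t + (s + 2)           ≡⟨ e₂ t s ⟩
      2 * suc t + s             ∎)
      where
      t = s ∸ m
      eq : s ≡ t + m
      eq = sym (m∸n+n≡m m≤s)
      e₁ : ∀ t m → (t + m) + (t + m) ≡ 2 * t + 2 * m
      e₁ = solve-∀
      e₂ : ∀ t s → 2 * t + (s + 2) ≡ 2 * suc t + s
      e₂ = solve-∀
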